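{- Let $2\le k\le \log n$. Assume the set intersection hypothesis (every data structure solving the set intersection problem on $N$ sets requires $\tilde\Omega(N^2)$ space). Then any $(2,1-k)$-stretch approximate distance oracle for graphs with $n$ vertices and maximum degree $\Theta(n^{1/k})$ must use $\tilde\Omega(n^2)$ space.
   Context: Graphs are undirected and unweighted; $d(u,v)$ is the length of a shortest path between $u$ and $v$ ($\infty$ if there is none); $k$ is an integer. An approximate distance oracle (ADO) for a graph $G=(V,E)$ is a data structure (word-RAM model, space counted in words) that, given any $u,v\in V$, returns in constant time an estimate $\hat d(u,v)$. For reals $\alpha>1$ and $\beta$ (possibly negative), it has $(\alpha,\beta)$-stretch if for all $u,v\in V$: $d(u,v)\le\hat d(u,v)\le\max\{d(u,v),\ \alpha\, d(u,v)+\beta\}$. Set intersection problem: let $X=\log^{c_0} N$ for a large enough constant $c_0$. Construct a data structure that preprocesses sets $S_1,\dots,S_N\subseteq[X]=\{1,\dots,X\}$ and answers queries of the form "does $S_i$ intersect $S_j$?" in constant time. Set intersection hypothesis: a data structure that solves the set intersection problem requires $\tilde\Omega(N^2)$ space. $\tilde\Omega(\cdot)$ suppresses poly-logarithmic factors. The lower bound is for the worst case over graphs in the stated family. -}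

module Defs where

open import Data.Bool.Base using (Bool; T; _∧_; _∨_; _xor_; if_then_else_)
open import Data.Empty using (⊥)
open import Data.Fin.Base using (Fin; toℕ)
open import Data.Fin.Subset using (Subset; ∣_∣; Nonempty; _∩_)
import Data.Integer.Base as ℤ
open import Data.Integer.Base using (ℤ; +_)
open import Data.List.Base using (List; []; _∷_; length; drop; head; tabulate)
open import Data.List.Extrema.Nat using (max)
open import Data.Maybe.Base using (Maybe; just; nothing; map)
open import Data.Nat.Base
  using (ℕ; zero; suc; _+_; _*_; _∸_; _^_; _≤_; _<_; _≡ᵇ_; _<ᵇ_; NonZero)
open import Data.Nat.DivMod using (_/_; _%_; _mod_)
open import Data.Nat.Logarithm using (⌊log₂_⌋)
open import Data.Nat.Properties using (m^n≢0)
open import Data.Product.Base using (∃-syntax; _×_; _,_)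
open import Data.Unit.Base using (⊤)
import Data.Vec.Base as Vec
open import Relation.Binary.PropositionalEquality.Core using (_≡_)
open import Relation.Nullary.Negation.Core using (¬_)

------------------------------------------------------------------------
-- Word RAM

-- A w-bit word, as a record so that w can be inferred from its type.
record Word (w : ℕ) : Set where
  constructor mkWord
  field
    index : Fin (2 ^ w)

value : ∀ {w} → Word w → ℕ
value x = toℕ (Word.index x)

word : ∀ w → ℕ → Word w
word w m = mkWord (_mod_ m (2 ^ w) {{m^n≢0 2 w}})

data Op : Set where
  add sub mul div rem and or xor shl shr : Op

bitwise : (Bool → Bool → Bool) → ℕ → ℕ → ℕ → ℕ
bitwise f zero    x y = 0
bitwise f (suc w) x y =
  (if f (x % 2 ≡ᵇ 1) (y % 2 ≡ᵇ 1) then 1 else 0) + 2 * bitwise f w (x / 2) (y / 2)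

-- Results are reduced modulo 2 ^ w afterwards; division and remainder by
-- zero yield zero.
evalℕ : ℕ → Op → ℕ → ℕ → ℕ
evalℕ w add x y       = x + y
evalℕ w sub x y       = (x + 2 ^ w) ∸ y
evalℕ w mul x y       = x * y
evalℕ w div x zero    = 0
evalℕ w div x (suc y) = x / suc y
evalℕ w rem x zero    = 0
evalℕ w rem x (suc y) = x % suc y
evalℕ w and x y       = bitwise _∧_ w x y
evalℕ w or  x y       = bitwise _∨_ w x y
evalℕ w xor x y       = bitwise _xor_ w x y
evalℕ w shl x y       = x * 2 ^ y
evalℕ w shr x y       = _/_ x (2 ^ y) {{m^n≢0 2 y}}

eval : ∀ {w} → Op → Word w → Word w → Word w
eval {w} o x y = word w (evalℕ w o (value x) (value y))

-- Register names, immediates, displacements and jump targets are constants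
-- of the program.  load and store use base-plus-displacement addressing.
data Instr : Set where
  imm   : (r c : ℕ) → Instr              -- r := c
  op    : (o : Op) (r a b : ℕ) → Instr   -- r := a `o` b
  load  : (r a c : ℕ) → Instr            -- r := mem[a + c]
  store : (a c r : ℕ) → Instr            -- mem[a + c] := r
  jmp   : (ℓ : ℕ) → Instr
  jlt   : (a b ℓ : ℕ) → Instr            -- jump to ℓ if a < b
  halt  : Instr

Program : Set
Program = List Instr

record State (w : ℕ) : Set where
  constructor state
  field
    pc  : ℕ
    reg : ℕ → Word w
    mem : ℕ → Word w

_[_≔_] : ∀ {A : Set} → (ℕ → A) → ℕ → A → ℕ → A
(f [ i ≔ a ]) j = if j ≡ᵇ i then a else f j

exec : ∀ {w} → Instr → State w → Maybe (State w)
exec {w} (imm r c)     (state p R M) = just (state (suc p) (R [ r ≔ word w c ]) M)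
exec     (op o r a b)  (state p R M) = just (state (suc p) (R [ r ≔ eval o (R a) (R b) ]) M)
exec     (load r a c)  (state p R M) = just (state (suc p) (R [ r ≔ M (value (R a) + c) ]) M)
exec     (store a c r) (state p R M) = just (state (suc p) R (M [ value (R a) + c ≔ R r ]))
exec     (jmp ℓ)       (state p R M) = just (state ℓ R M)
exec     (jlt a b ℓ)   (state p R M) =
  just (state (if value (R a) <ᵇ value (R b) then ℓ else suc p) R M)
exec     halt          _             = nothing

-- One step; nothing means that the machine has halted, either by halt or
-- because the program counter is outside the program.
step : ∀ {w} → Program → State w → Maybe (State w)
step P σ with head (drop (State.pc σ) P)
... | nothing = nothing
... | just i  = exec i σ

-- run P t σ is the halting state if P halts from σ after at most t steps.
run : ∀ {w} → Program → ℕ → State w → Maybe (State w)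
run P t σ with step P σ
run P t       σ | nothing = just σ
run P zero    σ | just σ′ = nothing
run P (suc t) σ | just σ′ = run P t σ′

contents : ∀ {w} → List (Word w) → ℕ → Word w
contents {w} []   _       = word w 0
contents (x ∷ xs) zero    = x
contents (x ∷ xs) (suc a) = contents xs a

inputs : ∀ {w} → Word w → Word w → ℕ → Word w
inputs x y 0 = x
inputs x y 1 = y
inputs {w} x y (suc (suc _)) = word w 0

------------------------------------------------------------------------
-- Data-structure problems and their space complexity

-- Every query is a pair of indices below the size parameter n and is
-- answered by one word.  Correct is only demanded for admissible n.
record Problem : Set₁ where
  field
    Admissible : ℕ → Set
    Instance   : ℕ → Set
    Correct    : ∀ {n w} → Instance n → (i j : Fin n) → Word w → Set

-- Words have Θ(log n) bits, enough to name all indices.  Preprocessing is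
-- unrestricted; queries are answered by a single program, in a number of
-- steps independent of n, of the instance and of the query.
record DataStructure (𝒫 : Problem) : Set where
  open Problem 𝒫
  field
    wordSize       : ℕ → ℕ
    wordSize-lower : ∀ n → n < 2 ^ wordSize n
    wordFactor     : ℕ
    wordSize-upper : ∀ n → wordSize n ≤ wordFactor * suc ⌊log₂ n ⌋
    preprocess     : ∀ n → Instance n → List (Word (wordSize n))
    program        : Program
    time           : ℕ

  answer : ∀ n → Instance n → (i j : Fin n) → Maybe (Word (wordSize n))
  answer n I i j =
    map (λ σ → State.reg σ 0)
        (run program time
          (state 0 (inputs (word _ (toℕ i)) (word _ (toℕ j))) (contents (preprocess n I))))

  Solves : Set
  Solves = ∀ n → Admissible n → (I : Instance n) (i j : Fin n) →
    ∃[ a ] answer n I i j ≡ just a × Correct I i j a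

  UsesAtMost : (ℕ → ℕ) → Set
  UsesAtMost s = ∀ n → Admissible n → (I : Instance n) → length (preprocess n I) ≤ s n

-- s = Ω̃(f) as n → ∞ within A.  A constant factor is absorbed by the power
-- of the logarithm.
Ω̃-within : (A : ℕ → Set) (f s : ℕ → ℕ) → Set
Ω̃-within A f s =
  ∃[ c ] ∃[ n₀ ] (∀ n → n₀ ≤ n → A n → f n ≤ s n * ⌊log₂ n ⌋ ^ c)

RequiresSpaceΩ̃ : (ℕ → ℕ) → Problem → Set
RequiresSpaceΩ̃ f 𝒫 =
  (D : DataStructure 𝒫) → DataStructure.Solves D →
  (s : ℕ → ℕ) → DataStructure.UsesAtMost D s →
  Ω̃-within (Problem.Admissible 𝒫) f s

------------------------------------------------------------------------
-- Set intersection

-- The answer "yes" is the word 1 and "no" the word 0.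
SetIntersection : ℕ → Problem
SetIntersection c₀ = record
  { Admissible = λ _ → ⊤
  ; Instance   = λ N → Fin N → Subset (⌊log₂ N ⌋ ^ c₀)
  ; Correct    = λ S i j a →
      (Nonempty (S i ∩ S j) → value a ≡ 1) × (¬ Nonempty (S i ∩ S j) → value a ≡ 0)
  }

-- Enlarging the universe only makes the problem harder, so "for some c₀" is
-- the same as "for every large enough c₀".
SetIntersectionHypothesis : Set
SetIntersectionHypothesis = ∃[ c₀ ] RequiresSpaceΩ̃ (λ N → N ^ 2) (SetIntersection c₀)

------------------------------------------------------------------------
-- Graphs

record Graph (n : ℕ) : Set where
  field
    adj         : Fin n → Fin n → Bool
    adj-sym     : ∀ u v → T (adj u v) → T (adj v u)
    adj-irrefl  : ∀ u → ¬ T (adj u u)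

  neighbours : Fin n → Subset n
  neighbours u = Vec.tabulate (adj u)

  degree : Fin n → ℕ
  degree u = ∣ neighbours u ∣

  maxDegree : ℕ
  maxDegree = max 0 (tabulate degree)

  -- Vertices may repeat; a shortest such path has no repetition.
  data Path : Fin n → Fin n → ℕ → Set where
    []  : ∀ {u} → Path u u 0
    _∷_ : ∀ {u v x ℓ} → T (adj u v) → Path v x ℓ → Path u x (suc ℓ)

-- Lengths in ℕ ∪ {∞}, with ∞ represented by nothing.
IsDistance : ∀ {n} → Graph n → (u v : Fin n) → Maybe ℕ → Set
IsDistance G u v (just d) = Path u v d × (∀ ℓ → Path u v ℓ → d ≤ ℓ)
  where open Graph G
IsDistance G u v nothing  = ∀ ℓ → ¬ Path u v ℓ
  where open Graph G

------------------------------------------------------------------------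
-- Approximate distance oracles

-- d ≤ d̂ ≤ max {d , α d + β}; the last two cases are those where exactly
-- one of d and d̂ is ∞.
WithinStretch : (α β : ℤ) (d d̂ : Maybe ℕ) → Set
WithinStretch α β (just d) (just d̂) =
  d ≤ d̂ × (+ d̂) ℤ.≤ ((+ d) ℤ.⊔ (α ℤ.* (+ d) ℤ.+ β))
WithinStretch α β nothing  nothing  = ⊤
WithinStretch α β (just _) nothing  = ⊥
WithinStretch α β nothing  (just _) = ⊥

-- The all-ones word stands for ∞.
estimate : ∀ {w} → Word w → Maybe ℕ
estimate {w} a = if suc (value a) ≡ᵇ 2 ^ w then nothing else just (value a)

-- Oracles for the graphs G in a family, with stretch depending on the number
-- of vertices.  Since distances are integers, rounding a real estimate down
-- preserves its stretch, so integer estimates lose no generality.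
ADO : (Admissible : ℕ → Set) (Family : ∀ {n} → Graph n → Set) (α β : ℕ → ℤ) → Problem
ADO Admissible Family α β = record
  { Admissible = Admissible
  ; Instance   = λ n → ∃[ G ] Family {n} G
  ; Correct    = λ {n} (G , _) u v a →
      ∀ d → IsDistance G u v d → WithinStretch (α n) (β n) d (estimate a)
  }

-- (1/A) n^(1/k) ≤ Δ ≤ B n^(1/k), raised to the k-th power.
MaxDegreeΘRoot : (A B : ℕ) (k : ℕ → ℕ) → ∀ {n} → Graph n → Set
MaxDegreeΘRoot A B k {n} G =
  n ≤ (A * maxDegree) ^ k n × maxDegree ^ k n ≤ B ^ k n * n
  where open Graph G

{-# OPTIONS --safe #-}
-- Let r be about n^(1/k).  N = n / polylog n sets over a universe of polylog n
-- elements are turned into a layered graph with k + 1 layers, whose vertices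
-- carry an element y and a set index p.  A monotone path from the bottom vertex
-- of the set i to the top vertex of the set j writes an element y of both sets,
-- overwrites the digits of i in base r by those of j, and erases y again, so
-- that all degrees are O(r).  Such a path has length k and exists if and only
-- if the two sets intersect; every other path between the two vertices is
-- longer by at least 2, since each edge changes the layer by one.  As stretch
-- (2, 1 - k) allows at most k + 1 for the distance k, comparing the estimate
-- with k + 2 decides whether the sets intersect.
--
-- The hypothesis bounds the space for N sets, and many n lead to the same N.
-- The data structure for N sets therefore uses the oracle for that n whose
-- space bound is least, and stores the table of all answers if there is no
-- suitable n.
module Submission where

open import Defs
open import Data.Bool.Base using (Bool; true; false; T; if_then_else_)
open import Data.Bool.Properties using (T-≡)
open import Data.Empty using (⊥)
open import Data.Fin.Base using (Fin; toℕ; fromℕ<; zero; suc; combine; remQuot)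
import Data.Fin.Base as Fin
open import Data.Fin.Properties using (toℕ<n; toℕ-injective; toℕ-fromℕ<; any?; toℕ-combine; remQuot-combine)
open import Data.Fin.Subset using (Subset; ∣_∣; _∪_; ⁅_⁆; _∈_; _⊆_; inside; outside; Nonempty; _∩_) renaming (⊥ to ∅)
open import Data.Fin.Subset.Properties using (∣⊥∣≡0; ∣⁅x⁆∣≡1; p⊆q⇒∣p∣≤∣q∣; x∈p∪q⁺; x∈⁅x⁆; _∈?_; x∈p∩q⁺; x∈p∩q⁻; nonempty?)
import Data.Integer.Base as ℤ
open import Data.Integer.Base using (+_; _-_)
import Data.Integer.Properties as ℤ
import Data.Integer.Tactic.RingSolver as ℤ-Solver
open import Data.List.Base using (List; []; _∷_; _++_; length; drop; tabulate; head; map)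
open import Data.List.Extrema.Nat using (max≤v⁺; xs≤max)
open import Data.List.Membership.Propositional.Properties using (∈-tabulate⁺)
open import Data.List.Properties using (length-++; length-map; length-tabulate)
import Data.List.Relation.Unary.All as All
open import Data.List.Relation.Unary.All.Properties using () renaming (tabulate⁺ to All-tabulate⁺)
open import Data.Maybe.Base using (just; nothing; Maybe)
import Data.Maybe.Base as Maybe
open import Data.Nat.Base
open import Data.Nat.DivMod
open import Data.Nat.Divisibility using (n∣m*n; m∣m*n)
open import Data.Nat.Induction using (<-rec)
open import Data.Nat.Logarithm
open import Data.Nat.Properties
open import Data.Nat.Tactic.RingSolver using (solve-∀)
open import Data.Product.Base using (∃-syntax; _×_; _,_; proj₁; proj₂)
open import Data.Sum.Base using (_⊎_; inj₁; inj₂; swap; [_,_]′)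
open import Data.Unit.Base using (tt)
import Data.Vec.Base as Vec
open import Data.Vec.Properties using (lookup∘tabulate; []=⇒lookup)
open import Function.Bundles using (Equivalence)
open import Relation.Binary.PropositionalEquality
open import Relation.Nullary.Decidable.Core using (Dec; yes; no; _×-dec_; T?; _⊎-dec_; ⌊_⌋; toWitness; fromWitness; does)
open import Relation.Nullary.Negation.Core using (contradiction; ¬_)

-- A path has only `k` edges of fan-out `r`, and only `n ≤ r ^ k` is known, so almost all of the
-- fan-out must go into replacing the digits of i. Three choices keep the price of y
-- polylogarithmic. Membership is a guard on edges that overwrite a digit anyway, so testing it
-- costs no edge. Writing and erasing y reduce the reach by a factor of at most X^4, where X is a
-- polylogarithmic bound on the universe; this is the slack demanded between N and n. The vertices
-- number about k · X^2 · 2N, and k ≤ log n keeps the number of layers polylogarithmic as well.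
-- Erasing y makes the end of the path depend on j alone, so that a single distance query decides
-- about all elements at once. The function k is arbitrary, so no formula turns N into a good n, and
-- a search over n is needed. Since one program must serve all N, the oracle and the table share a
-- program that reads its mode from memory.

-- Digits

-- z and z′ differ at most in the digit of weight lo and radix e.
Agree : (lo e : ℕ) .{{_ : NonZero lo}} .{{_ : NonZero e}} → ℕ → ℕ → Set
Agree lo e z z′ = z % lo ≡ z′ % lo × (z / lo) / e ≡ (z′ / lo) / e

agree? : ∀ lo e .{{_ : NonZero lo}} .{{_ : NonZero e}} z z′ → Dec (Agree lo e z z′)
agree? lo e z z′ = (z % lo ≟ z′ % lo) ×-dec ((z / lo) / e ≟ (z′ / lo) / e)

Agree-sym : ∀ {lo e} .{{_ : NonZero lo}} .{{_ : NonZero e}} {z z′} →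
  Agree lo e z z′ → Agree lo e z′ z
Agree-sym (p , q) = sym p , sym q

Agree-1-1⇒≡ : ∀ {z z′} → Agree 1 1 z z′ → z ≡ z′
Agree-1-1⇒≡ {z} {z′} (_ , q) = begin
  z            ≡⟨ n/1≡n z ⟨
  z / 1        ≡⟨ n/1≡n (z / 1) ⟨
  z / 1 / 1    ≡⟨ q ⟩
  z′ / 1 / 1   ≡⟨ n/1≡n (z′ / 1) ⟩
  z′ / 1       ≡⟨ n/1≡n z′ ⟩
  z′           ∎
  where open ≡-Reasoning

overwrite : (lo e : ℕ) .{{_ : NonZero lo}} .{{_ : NonZero e}} → ℕ → ℕ → ℕ
overwrite lo e z d = z % lo + (d + (z / lo) / e * e) * lo

-- The neighbours of a label can be enumerated by the new digit alone, which is what bounds the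
-- degrees.
overwrite-agree : ∀ {lo e} .{{_ : NonZero lo}} .{{_ : NonZero e}} {z z′} →
  Agree lo e z z′ → overwrite lo e z ((z′ / lo) % e) ≡ z′
overwrite-agree {lo} {e} {z} {z′} (p , q) = begin
  z % lo + ((z′ / lo) % e + (z / lo) / e * e) * lo
    ≡⟨ cong₂ (λ a b → a + ((z′ / lo) % e + b * e) * lo) p q ⟩
  z′ % lo + ((z′ / lo) % e + (z′ / lo) / e * e) * lo
    ≡⟨ cong (λ a → z′ % lo + a * lo) (sym (m≡m%n+[m/n]*n (z′ / lo) e)) ⟩
  z′ % lo + (z′ / lo) * lo
    ≡⟨ sym (m≡m%n+[m/n]*n z′ lo) ⟩
  z′ ∎
  where open ≡-Reasoning

[m*n+o]%n≡o : ∀ m {n o} .{{_ : NonZero n}} → o < n → (m * n + o) % n ≡ o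
[m*n+o]%n≡o m {n} {o} o<n = begin
  (m * n + o) % n ≡⟨ cong (_% n) (+-comm (m * n) o) ⟩
  (o + m * n) % n ≡⟨ [m+kn]%n≡m%n o m n ⟩
  o % n           ≡⟨ m<n⇒m%n≡m o<n ⟩
  o               ∎
  where open ≡-Reasoning

[m*n+o]/n≡m : ∀ m {n o} .{{_ : NonZero n}} → o < n → (m * n + o) / n ≡ m
[m*n+o]/n≡m m {n} {o} o<n = begin
  (m * n + o) / n     ≡⟨ +-distrib-/-∣ˡ o (n∣m*n m) ⟩
  m * n / n + o / n   ≡⟨ cong₂ _+_ (m*n/n≡m m n) (m<n⇒m/n≡0 o<n) ⟩
  m + 0               ≡⟨ +-identityʳ m ⟩
  m                   ∎
  where open ≡-Reasoning

-- The index carried halfway along a path: digits of weight below `lo` already come from `j`, the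
-- others still from `i`.
splice : (lo : ℕ) .{{_ : NonZero lo}} → ℕ → ℕ → ℕ
splice lo i j = (i / lo) * lo + j % lo

splice-≡1 : ∀ {lo} .{{_ : NonZero lo}} i j → lo ≡ 1 → splice lo i j ≡ i
splice-≡1 i j refl = begin
  i / 1 * 1 + j % 1 ≡⟨ cong₂ (λ a b → a * 1 + b) (n/1≡n i) (n%1≡0 j) ⟩
  i * 1 + 0         ≡⟨ +-identityʳ (i * 1) ⟩
  i * 1             ≡⟨ *-identityʳ i ⟩
  i                 ∎
  where open ≡-Reasoning

splice-≥ : ∀ {lo} .{{_ : NonZero lo}} {i j} → i < lo → j < lo → splice lo i j ≡ j
splice-≥ {lo} i<lo j<lo = cong₂ (λ a b → a * lo + b) (m<n⇒m/n≡0 i<lo) (m<n⇒m%n≡m j<lo)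

-- A splice can exceed both of its arguments, which is why the networks provide `2 * N` indices
-- instead of `N`.
splice-< : ∀ lo .{{_ : NonZero lo}} {N i j} → i < N → j < N → splice lo i j < 2 * N
splice-< lo {N} {i} {j} i<N j<N = begin-strict
  (i / lo) * lo + j % lo ≤⟨ +-mono-≤ (m/n*n≤m i lo) (m%n≤m j lo) ⟩
  i + j                  <⟨ +-mono-< i<N j<N ⟩
  N + N                  ≡⟨ cong (λ x → N + x) (sym (+-identityʳ N)) ⟩
  2 * N                  ∎
  where open ≤-Reasoning

-- Both splices have the low part `j % lo`, and without the next digit of radix `e` both leave
-- `i / (lo * e)`. Consecutive splices are thus joined by an edge.
splice-agree : ∀ {lo e lo′} .{{_ : NonZero lo}} .{{_ : NonZero e}} .{{_ : NonZero lo′}} i j →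
  lo′ ≡ lo * e → Agree lo e (splice lo i j) (splice lo′ i j)
splice-agree {lo} {e} i j refl = low , high
  where
  open ≡-Reasoning
  a = i / (lo * e)
  b = j % (lo * e)
  shuffle : ∀ a l e x y → a * (l * e) + (x + y * l) ≡ (a * e + y) * l + x
  shuffle = solve-∀
  regroup : splice (lo * e) i j ≡ (a * e + b / lo) * lo + j % lo
  regroup = begin
    a * (lo * e) + b                       ≡⟨ cong (λ x → a * (lo * e) + x) (m≡m%n+[m/n]*n b lo) ⟩
    a * (lo * e) + (b % lo + b / lo * lo)  ≡⟨ cong (λ c → a * (lo * e) + (c + b / lo * lo))
                                                (m∣n⇒o%n%m≡o%m lo (lo * e) j (m∣m*n e)) ⟩
    a * (lo * e) + (j % lo + b / lo * lo)  ≡⟨ shuffle a lo e (j % lo) (b / lo) ⟩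
    (a * e + b / lo) * lo + j % lo         ∎
  low : splice lo i j % lo ≡ splice (lo * e) i j % lo
  low = begin
    splice lo i j % lo                     ≡⟨ [m*n+o]%n≡o (i / lo) (m%n<n j lo) ⟩
    j % lo                                 ≡⟨ [m*n+o]%n≡o (a * e + b / lo) (m%n<n j lo) ⟨
    ((a * e + b / lo) * lo + j % lo) % lo  ≡⟨ cong (_% lo) regroup ⟨
    splice (lo * e) i j % lo               ∎
  high : splice lo i j / lo / e ≡ splice (lo * e) i j / lo / e
  high = begin
    splice lo i j / lo / e        ≡⟨ cong (_/ e) ([m*n+o]/n≡m (i / lo) (m%n<n j lo)) ⟩
    i / lo / e                    ≡⟨ m/n/o≡m/[n*o] i lo e ⟩
    i / (lo * e)                  ≡⟨ [m*n+o]/n≡m (i / (lo * e)) (m%n<n j (lo * e)) ⟨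
    splice (lo * e) i j / (lo * e) ≡⟨ m/n/o≡m/[n*o] (splice (lo * e) i j) lo e ⟨
    splice (lo * e) i j / lo / e  ∎

-- Cardinalities of subsets

∣p∪q∣≤∣p∣+∣q∣ : ∀ {n} (p q : Subset n) → ∣ p ∪ q ∣ ≤ ∣ p ∣ + ∣ q ∣
∣p∪q∣≤∣p∣+∣q∣ Vec.[]            Vec.[]            = z≤n
∣p∪q∣≤∣p∣+∣q∣ (outside Vec.∷ p) (outside Vec.∷ q) = ∣p∪q∣≤∣p∣+∣q∣ p q
∣p∪q∣≤∣p∣+∣q∣ (outside Vec.∷ p) (inside  Vec.∷ q) =
  ≤-trans (s≤s (∣p∪q∣≤∣p∣+∣q∣ p q)) (≤-reflexive (sym (+-suc ∣ p ∣ ∣ q ∣)))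
∣p∪q∣≤∣p∣+∣q∣ (inside  Vec.∷ p) (outside Vec.∷ q) = s≤s (∣p∪q∣≤∣p∣+∣q∣ p q)
∣p∪q∣≤∣p∣+∣q∣ (inside  Vec.∷ p) (inside  Vec.∷ q) =
  s≤s (≤-trans (∣p∪q∣≤∣p∣+∣q∣ p q) (+-monoʳ-≤ ∣ p ∣ (n≤1+n ∣ q ∣)))

-- Values outside `Fin n` are dropped, so enumerations of neighbours may be total functions on
-- numbers.
image : ∀ {n} → (ℕ → ℕ) → ℕ → Subset n
image         g zero    = ∅
image {n}     g (suc m) with g m <? n
... | yes gm<n = ⁅ fromℕ< gm<n ⁆ ∪ image g m
... | no  _    = image g m

∣image∣≤ : ∀ {n} g m → ∣ image {n} g m ∣ ≤ m
∣image∣≤ {n} g zero = ≤-reflexive (∣⊥∣≡0 n)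
∣image∣≤ {n} g (suc m) with g m <? n
... | yes gm<n = begin
  ∣ ⁅ fromℕ< gm<n ⁆ ∪ image g m ∣       ≤⟨ ∣p∪q∣≤∣p∣+∣q∣ ⁅ fromℕ< gm<n ⁆ (image g m) ⟩
  ∣ ⁅ fromℕ< gm<n ⁆ ∣ + ∣ image {n} g m ∣   ≤⟨ +-mono-≤ (≤-reflexive (∣⁅x⁆∣≡1 (fromℕ< gm<n))) (∣image∣≤ g m) ⟩
  suc m                                  ∎
  where open ≤-Reasoning
... | no  _    = m≤n⇒m≤1+n (∣image∣≤ g m)

∈-image : ∀ {n} g {m d} {v : Fin n} → d < m → g d ≡ toℕ v → v ∈ image g m
∈-image {n} g {suc m} {d} {v} d<1+m gd≡v with d ≟ m
∈-image {n} g {suc m} {d} {v} d<1+m gd≡v | yes refl with g d <? n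
... | yes gd<n = x∈p∪q⁺ (inj₁ (subst (λ w → v ∈ ⁅ w ⁆) v≡ (x∈⁅x⁆ v)))
  where
  v≡ : v ≡ fromℕ< gd<n
  v≡ = toℕ-injective (trans (sym gd≡v) (sym (toℕ-fromℕ< gd<n)))
... | no  gd≮n = contradiction (subst (_< n) (sym gd≡v) (toℕ<n v)) gd≮n
∈-image {n} g {suc m} {d} {v} d<1+m gd≡v | no d≢m with g m <? n
... | yes _ = x∈p∪q⁺ (inj₂ (∈-image g (≤∧≢⇒< (s≤s⁻¹ d<1+m) d≢m) gd≡v))
... | no  _ = ∈-image g (≤∧≢⇒< (s≤s⁻¹ d<1+m) d≢m) gd≡v

∈-tabulate⁻ : ∀ {n} {f : Fin n → Bool} {v} → v ∈ Vec.tabulate f → T (f v)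
∈-tabulate⁻ {f = f} {v} v∈ =
  Equivalence.from T-≡ (trans (sym (lookup∘tabulate f v)) ([]=⇒lookup v∈))

covered⇒∣tabulate∣≤ : ∀ {n} (f : Fin n → Bool) g h m →
  (∀ v → T (f v) → (∃[ d ] d < m × g d ≡ toℕ v) ⊎ (∃[ d ] d < m × h d ≡ toℕ v)) →
  ∣ Vec.tabulate f ∣ ≤ m + m
covered⇒∣tabulate∣≤ {n} f g h m cover = begin
  ∣ Vec.tabulate f ∣               ≤⟨ p⊆q⇒∣p∣≤∣q∣ included ⟩
  ∣ image g m ∪ image h m ∣        ≤⟨ ∣p∪q∣≤∣p∣+∣q∣ (image g m) (image h m) ⟩
  ∣ image {n} g m ∣ + ∣ image {n} h m ∣    ≤⟨ +-mono-≤ (∣image∣≤ g m) (∣image∣≤ h m) ⟩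
  m + m                            ∎
  where
  open ≤-Reasoning
  included : Vec.tabulate f ⊆ image g m ∪ image h m
  included {v} v∈ with cover v (∈-tabulate⁻ v∈)
  ... | inj₁ (d , d<m , eq) = x∈p∪q⁺ (inj₁ (∈-image g d<m eq))
  ... | inj₂ (d , d<m , eq) = x∈p∪q⁺ (inj₂ (∈-image h d<m eq))

interval⇒≤∣tabulate∣ : ∀ {n} (f : Fin n → Bool) c m → c + m ≤ n →
  (∀ v → c ≤ toℕ v → toℕ v < c + m → T (f v)) → m ≤ ∣ Vec.tabulate f ∣
interval⇒≤∣tabulate∣ {zero} f c m c+m≤0 _ = ≤-trans (m≤n+m m c) c+m≤0
interval⇒≤∣tabulate∣ {suc n} f zero zero _ _ = z≤n
interval⇒≤∣tabulate∣ {suc n} f zero (suc m) m≤n all with f zero | all zero z≤n z<s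
... | true | _ = s≤s (interval⇒≤∣tabulate∣ (λ v → f (suc v)) zero m (s≤s⁻¹ m≤n)
                      (λ v _ v<m → all (suc v) z≤n (s≤s v<m)))
interval⇒≤∣tabulate∣ {suc n} f (suc c) m c+m≤n all with f zero
... | true  = m≤n⇒m≤1+n (interval⇒≤∣tabulate∣ (λ v → f (suc v)) c m (s≤s⁻¹ c+m≤n)
                (λ v c≤v v<m → all (suc v) (s≤s c≤v) (s≤s v<m)))
... | false = interval⇒≤∣tabulate∣ (λ v → f (suc v)) c m (s≤s⁻¹ c+m≤n)
                (λ v c≤v v<m → all (suc v) (s≤s c≤v) (s≤s v<m))

-- Layered networks

Label : Set
Label = ℕ × ℕ

-- A label consists of an element of the universe and the index of a set.  The
-- edges of a layer overwrite one digit of each, of weights ylo and plo and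
-- radices ye and pe.
record Layer (r : ℕ) : Set where
  field
    ylo ye plo pe : ℕ
    {{ylo≢0}}     : NonZero ylo
    {{ye≢0}}      : NonZero ye
    {{plo≢0}}     : NonZero plo
    {{pe≢0}}      : NonZero pe
    fan           : ye * pe ≤ r
    guard         : Label → Label → Bool

  Near : Label → Label → Set
  Near (y , p) (y′ , p′) = Agree ylo ye y y′ × Agree plo pe p p′

  Near-sym : ∀ {q q′} → Near q q′ → Near q′ q
  Near-sym (a , b) = Agree-sym a , Agree-sym b

  Move : Label → Label → Set
  Move q q′ = Near q q′ × T (guard q q′)

  move? : ∀ q q′ → Dec (Move q q′)
  move? q@(y , p) q′@(y′ , p′) =
    (agree? ylo ye y y′ ×-dec agree? plo pe p p′) ×-dec T? (guard q q′)

  near : Label → ℕ → Label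
  near (y , p) d = overwrite ylo ye y (d / pe) , overwrite plo pe p (d % pe)

  -- The two new digits are packed into one number below `ye * pe`. The guard is ignored, since it
  -- only removes edges; as `Near` is symmetric, the same enumeration serves edges out of a label
  -- and into it.
  near-covers : ∀ {q q′} → Near q q′ → ∃[ d ] d < r × near q d ≡ q′
  near-covers {y , p} {y′ , p′} (ay , ap) = d , <-≤-trans d< fan , cong₂ _,_ eqy eqp
    where
    dy = (y′ / ylo) % ye
    dp = (p′ / plo) % pe
    dp< : dp < pe
    dp< = m%n<n (p′ / plo) pe
    d = dy * pe + dp
    d< : d < ye * pe
    d< = begin-strict
      dy * pe + dp   <⟨ +-monoʳ-< (dy * pe) dp< ⟩
      dy * pe + pe   ≡⟨ +-comm (dy * pe) pe ⟩
      suc dy * pe    ≤⟨ *-monoˡ-≤ pe (m%n<n (y′ / ylo) ye) ⟩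
      ye * pe        ∎
      where open ≤-Reasoning
    eqy : overwrite ylo ye y (d / pe) ≡ y′
    eqy = trans (cong (overwrite ylo ye y) ([m*n+o]/n≡m dy dp<)) (overwrite-agree ay)
    eqp : overwrite plo pe p (d % pe) ≡ p′
    eqp = trans (cong (overwrite plo pe p) ([m*n+o]%n≡o dy dp<)) (overwrite-agree ap)

m/n<o⇒m<o*n : ∀ {m n o} .{{_ : NonZero n}} → m / n < o → m < o * n
m/n<o⇒m<o*n {m} {n} {o} m/n<o = begin-strict
  m                    ≡⟨ m≡m%n+[m/n]*n m n ⟩
  m % n + (m / n) * n  <⟨ +-monoˡ-< ((m / n) * n) (m%n<n m n) ⟩
  suc (m / n) * n      ≤⟨ *-monoˡ-≤ n m/n<o ⟩
  o * n                ∎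
  where open ≤-Reasoning

drop-∷⇒< : ∀ {a} {A : Set a} t (xs : List A) {x ys} → drop t xs ≡ x ∷ ys →
  t < length xs × drop (suc t) xs ≡ ys
drop-∷⇒< zero    (x ∷ xs) refl = z<s , refl
drop-∷⇒< (suc t) (x ∷ xs) eq with drop-∷⇒< t xs eq
... | t< , eq′ = s≤s t< , eq′

drop-length : ∀ {a} {A : Set a} (xs : List A) → drop (length xs) xs ≡ []
drop-length []       = refl
drop-length (_ ∷ xs) = drop-length xs

module Network {r : ℕ} (layers : List (Layer r)) (Y P n : ℕ)
  {{Y≢0 : NonZero Y}} {{P≢0 : NonZero P}}
  (room : suc (length layers) * Y * P + suc r ≤ n) where

  depth centre : ℕ
  depth = length layers
  centre = suc depth * Y * P

  encode : ℕ → Label → ℕ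
  encode t (y , p) = (t * Y + y) * P + p

  layer : ℕ → ℕ
  layer v = v / P / Y

  label : ℕ → Label
  label v = (v / P) % Y , v % P

  InRange : Label → Set
  InRange (y , p) = y < Y × p < P

  label-inRange : ∀ v → InRange (label v)
  label-inRange v = m%n<n (v / P) Y , m%n<n v P

  layer-encode : ∀ t {q} → InRange q → layer (encode t q) ≡ t
  layer-encode t {y , p} (y<Y , p<P) =
    trans (cong (_/ Y) ([m*n+o]/n≡m (t * Y + y) p<P)) ([m*n+o]/n≡m t y<Y)

  label-encode : ∀ t {q} → InRange q → label (encode t q) ≡ q
  label-encode t {y , p} (y<Y , p<P) = cong₂ _,_
    (trans (cong (_% Y) ([m*n+o]/n≡m (t * Y + y) p<P)) ([m*n+o]%n≡o t y<Y))
    ([m*n+o]%n≡o (t * Y + y) p<P)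

  encode-label : ∀ v → encode (layer v) (label v) ≡ v
  encode-label v = begin
    (v / P / Y * Y + (v / P) % Y) * P + v % P
      ≡⟨ cong (λ a → a * P + v % P) (trans (+-comm (v / P / Y * Y) ((v / P) % Y)) (sym (m≡m%n+[m/n]*n (v / P) Y))) ⟩
    (v / P) * P + v % P
      ≡⟨ trans (+-comm ((v / P) * P) (v % P)) (sym (m≡m%n+[m/n]*n v P)) ⟩
    v ∎
    where open ≡-Reasoning

  -- Separates the network from the star: the centre and its leaves have layers above `depth`, so no
  -- `Forward` arc touches them.
  layer≤depth⇒<centre : ∀ {v} → layer v ≤ depth → v < centre
  layer≤depth⇒<centre lv = m/n<o⇒m<o*n (m/n<o⇒m<o*n (s≤s lv))

  encode<n : ∀ {t q} → t ≤ depth → InRange q → encode t q < n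
  encode<n {t} t≤ q∈ =
    <-≤-trans (layer≤depth⇒<centre (subst (_≤ depth) (sym (layer-encode t q∈)) t≤))
              (m+n≤o⇒m≤o centre room)

  StepIn : List (Layer r) → Label → Label → Set
  StepIn []      _ _  = ⊥
  StepIn (L ∷ _) q q′ = Layer.Move L q q′

  stepIn? : ∀ Ls q q′ → Dec (StepIn Ls q q′)
  stepIn? []      q q′ = no λ ()
  stepIn? (L ∷ _) q q′ = Layer.move? L q q′

  Forward : ℕ → ℕ → Set
  Forward u v = layer v ≡ suc (layer u) × StepIn (drop (layer u) layers) (label u) (label v)

  -- The star only serves to make the maximum degree at least r.
  Star : ℕ → ℕ → Set
  Star u v = u ≡ centre × centre < v × v ≤ centre + r

  Arc : ℕ → ℕ → Set
  Arc u v = Forward u v ⊎ Star u v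

  arc? : ∀ u v → Dec (Arc u v)
  arc? u v =
    ((layer v ≟ suc (layer u)) ×-dec stepIn? (drop (layer u) layers) (label u) (label v))
    ⊎-dec ((u ≟ centre) ×-dec ((centre <? v) ×-dec (v ≤? centre + r)))

  Forward⇒< : ∀ {u v} → Forward u v → layer u < depth
  Forward⇒< {u} (_ , s) with drop (layer u) layers in eq
  ... | L ∷ _ = proj₁ (drop-∷⇒< (layer u) layers eq)

  edge? : ∀ u v → Dec (Arc u v ⊎ Arc v u)
  edge? u v = arc? u v ⊎-dec arc? v u

  ¬Arc-refl : ∀ {u} → ¬ Arc u u
  ¬Arc-refl (inj₁ (eq , _))         = 1+n≢n (sym eq)
  ¬Arc-refl (inj₂ (refl , c<c , _)) = <-irrefl refl c<c

  graph : Graph n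
  graph = record
    { adj        = λ u v → ⌊ edge? (toℕ u) (toℕ v) ⌋
    ; adj-sym    = λ u v e → fromWitness (swap (toWitness {a? = edge? (toℕ u) (toℕ v)} e))
    ; adj-irrefl = λ u e → irrefl (toWitness {a? = edge? (toℕ u) (toℕ u)} e)
    }
    where
    irrefl : ∀ {u} → ¬ (Arc u u ⊎ Arc u u)
    irrefl (inj₁ a) = ¬Arc-refl a
    irrefl (inj₂ a) = ¬Arc-refl a

  open Graph graph

  nearIn : List (Layer r) → Label → ℕ → Label
  nearIn []      q d = q
  nearIn (L ∷ _) q d = Layer.near L q d

  nearIn-covers : ∀ Ls {q q′} → StepIn Ls q q′ ⊎ StepIn Ls q′ q → ∃[ d ] d < r × nearIn Ls q d ≡ q′
  nearIn-covers (L ∷ _) (inj₁ (m , _)) = Layer.near-covers L m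
  nearIn-covers (L ∷ _) (inj₂ (m , _)) = Layer.near-covers L (Layer.Near-sym L m)

  -- The centre has only star arcs going out and every other vertex only forward arcs, so `r` values
  -- suffice in either case.
  successor : ℕ → ℕ → ℕ
  successor u d with u ≟ centre
  ... | yes _ = suc centre + d
  ... | no  _ = encode (suc (layer u)) (nearIn (drop (layer u) layers) (label u) d)

  successor-covers : ∀ {u v} → Arc u v → ∃[ d ] d < r × successor u d ≡ v
  successor-covers {u} {v} (inj₁ f@(lv , s)) with u ≟ centre
  ... | yes refl = contradiction (<⇒≤ (Forward⇒< {u} {v} f)) λ lu → <-irrefl refl (layer≤depth⇒<centre lu)
  ... | no  _ with nearIn-covers (drop (layer u) layers) (inj₁ s)
  ...   | d , d<r , eq = d , d<r , trans (cong₂ encode (sym lv) eq) (encode-label v)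
  successor-covers {u} {v} (inj₂ (u≡c , c<v , v≤c+r)) with u ≟ centre
  ... | yes _ = v ∸ suc centre
    , (begin-strict
        v ∸ suc centre               <⟨ ∸-monoˡ-< (s≤s v≤c+r) c<v ⟩
        suc (centre + r) ∸ suc centre ≡⟨ m+n∸m≡n centre r ⟩
        r                            ∎)
    , m+[n∸m]≡n c<v
    where open ≤-Reasoning
  ... | no u≢c = contradiction u≡c u≢c

  predecessor : ℕ → ℕ → ℕ
  predecessor v d with centre <? v
  ... | yes _ = centre
  ... | no  _ = encode (pred (layer v)) (nearIn (drop (pred (layer v)) layers) (label v) d)

  predecessor-covers : ∀ {u v} → 0 < r → Arc u v → ∃[ d ] d < r × predecessor v d ≡ u
  predecessor-covers {u} {v} _ (inj₁ f@(lv , s)) with centre <? v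
  ... | yes c<v = contradiction (layer≤depth⇒<centre (subst (_≤ depth) (sym lv) (Forward⇒< {u} {v} f)))
                                (<⇒≯ c<v)
  ... | no  _ with nearIn-covers (drop (layer u) layers) (inj₂ s)
  ...   | d , d<r , eq = d , d<r , (begin
            encode (pred (layer v)) (nearIn (drop (pred (layer v)) layers) (label v) d)
              ≡⟨ cong (λ t → encode t (nearIn (drop t layers) (label v) d)) (cong pred lv) ⟩
            encode (layer u) (nearIn (drop (layer u) layers) (label v) d)
              ≡⟨ cong (encode (layer u)) eq ⟩
            encode (layer u) (label u)
              ≡⟨ encode-label u ⟩
            u ∎)
            where open ≡-Reasoning
  predecessor-covers {u} {v} 0<r (inj₂ (u≡c , c<v , _)) with centre <? v
  -- A leaf has the centre as its only predecessor, whatever the index.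
  ... | yes _  = 0 , 0<r , sym u≡c
  ... | no c≮v = contradiction c<v c≮v

  degree≤ : 0 < r → ∀ u → degree u ≤ r + r
  degree≤ 0<r u = covered⇒∣tabulate∣≤ (adj u) (successor (toℕ u)) (predecessor (toℕ u)) r cover
    where
    cover : ∀ v → T (adj u v) →
      (∃[ d ] d < r × successor (toℕ u) d ≡ toℕ v) ⊎ (∃[ d ] d < r × predecessor (toℕ u) d ≡ toℕ v)
    cover v e with toWitness {a? = edge? (toℕ u) (toℕ v)} e
    ... | inj₁ a = inj₁ (successor-covers a)
    ... | inj₂ a = inj₂ (predecessor-covers 0<r a)

  maxDegree≤ : 0 < r → maxDegree ≤ r + r
  maxDegree≤ 0<r = max≤v⁺ {xs = tabulate degree} z≤n (All-tabulate⁺ (degree≤ 0<r))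

  r≤maxDegree : r ≤ maxDegree
  r≤maxDegree = ≤-trans
    (interval⇒≤∣tabulate∣ (adj u) (suc centre) r (subst (_≤ n) (+-suc centre r) room) leaf)
    (All.lookup (xs≤max 0 (tabulate degree)) (∈-tabulate⁺ {f = degree} u))
    where
    c<n : centre < n
    c<n = <-≤-trans (m<m+n centre z<s) room
    u : Fin n
    u = fromℕ< c<n
    leaf : ∀ v → suc centre ≤ toℕ v → toℕ v < suc centre + r → T (adj u v)
    leaf v c<v v< = fromWitness {a? = edge? (toℕ u) (toℕ v)}
      (inj₁ (inj₂ (toℕ-fromℕ< c<n , c<v , s≤s⁻¹ v<)))

  -- A monotone path reduced to its labels, with one move per layer, so that it can be joined and
  -- split along the list of layers.
  data Chain : List (Layer r) → Label → Label → Set where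
    []  : ∀ {q} → Chain [] q q
    _∷_ : ∀ {L Ls q q′ q″} → Layer.Move L q q′ × InRange q′ → Chain Ls q′ q″ → Chain (L ∷ Ls) q q″

  _++ᶜ_ : ∀ {Ls Ls′ q q′ q″} → Chain Ls q q′ → Chain Ls′ q′ q″ → Chain (Ls ++ Ls′) q q″
  []      ++ᶜ d = d
  (m ∷ c) ++ᶜ d = m ∷ (c ++ᶜ d)

  split : ∀ Ls {Ls′ q q″} → Chain (Ls ++ Ls′) q q″ → ∃[ q′ ] Chain Ls q q′ × Chain Ls′ q′ q″
  split []       c       = _ , [] , c
  split (L ∷ Ls) (m ∷ c) with split Ls c
  ... | q′ , c₁ , c₂ = q′ , m ∷ c₁ , c₂

  -- Every edge changes the layer by one, so a path that is not monotone
  -- loses at least two steps.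
  path⇒excess : ∀ {u v ℓ} → Path u v ℓ → layer (toℕ u) ≤ depth → layer (toℕ v) ≡ depth →
    ∃[ b ] layer (toℕ u) + ℓ ≡ depth + 2 * b ×
      (b ≡ 0 → Chain (drop (layer (toℕ u)) layers) (label (toℕ u)) (label (toℕ v)))
  path⇒excess {u} [] lu lv = 0 , cong (_+ 0) lv ,
    λ _ → subst (λ Ls → Chain Ls (label (toℕ u)) (label (toℕ u)))
                (sym (trans (cong (λ t → drop t layers) lv) (drop-length layers))) []
  path⇒excess {u} {v} {suc ℓ} (_∷_ {v = x} e π) lu lv
    with toWitness {a? = edge? (toℕ u) (toℕ x)} e
  ... | inj₁ (inj₂ (u≡c , _)) = contradiction (layer≤depth⇒<centre lu) (<-irrefl u≡c)
  ... | inj₂ (inj₂ (_ , c<u , _)) = contradiction (layer≤depth⇒<centre lu) (<⇒≯ c<u)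
  ... | inj₁ (inj₁ f@(lx , s)) with path⇒excess π (subst (_≤ depth) (sym lx) (Forward⇒< {toℕ u} {toℕ x} f)) lv
  ...   | b , eq , chain = b
          , trans (+-suc _ ℓ) (trans (cong (_+ ℓ) (sym lx)) eq)
          , λ b≡0 → extend (subst (λ t → Chain (drop t layers) (label (toℕ x)) (label (toℕ v))) lx (chain b≡0)) s
    where
    extend : ∀ {q′} → Chain (drop (suc (layer (toℕ u))) layers) (label (toℕ x)) q′ →
      StepIn (drop (layer (toℕ u)) layers) (label (toℕ u)) (label (toℕ x)) →
      Chain (drop (layer (toℕ u)) layers) (label (toℕ u)) q′
    extend {q′} c s with drop (layer (toℕ u)) layers in eq
    ... | L ∷ Ls = (s , label-inRange (toℕ x)) ∷
                   subst (λ Ls → Chain Ls (label (toℕ x)) q′) (proj₂ (drop-∷⇒< (layer (toℕ u)) layers eq)) c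
  -- `b` counts the backward edges. Having just met one, nothing need be shown about chains, as
  -- `suc b ≡ 0` is absurd.
  path⇒excess {u} {v} {suc ℓ} (_∷_ {v = x} e π) lu lv
      | inj₂ (inj₁ f@(lu≡ , s)) with path⇒excess π (≤-trans (n≤1+n _) (subst (_≤ depth) lu≡ lu)) lv
  ...   | b , eq , _ = suc b
          , (begin
              layer (toℕ u) + suc ℓ          ≡⟨ cong (_+ suc ℓ) lu≡ ⟩
              suc (layer (toℕ x)) + suc ℓ    ≡⟨ cong suc (+-suc (layer (toℕ x)) ℓ) ⟩
              2 + (layer (toℕ x) + ℓ)        ≡⟨ cong (λ x → 2 + x) eq ⟩
              2 + (depth + 2 * b)            ≡⟨ shuffle depth b ⟩
              depth + 2 * suc b              ∎)
          , λ ()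
    where
    open ≡-Reasoning
    shuffle : ∀ d b → 2 + (d + 2 * b) ≡ d + 2 * suc b
    shuffle = solve-∀

  chain⇒path : ∀ {Ls q q′} → Chain Ls q q′ → ∀ {u v} t → drop t layers ≡ Ls →
    layer (toℕ u) ≡ t → label (toℕ u) ≡ q →
    layer (toℕ v) ≡ t + length Ls → label (toℕ v) ≡ q′ → Path u v (length Ls)
  chain⇒path [] {u} {v} t eq lu qu lv qv = subst (λ w → Path u w 0) u≡v []
    where
    u≡v : u ≡ v
    u≡v = toℕ-injective (begin
      toℕ u                                   ≡⟨ encode-label (toℕ u) ⟨
      encode (layer (toℕ u)) (label (toℕ u))  ≡⟨ cong₂ encode (trans lu (sym (trans lv (+-identityʳ t)))) (trans qu (sym qv)) ⟩
      encode (layer (toℕ v)) (label (toℕ v))  ≡⟨ encode-label (toℕ v) ⟩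
      toℕ v                                   ∎)
      where open ≡-Reasoning
  chain⇒path {L ∷ Ls} {q} (_∷_ {q′ = q₁} (m , q₁∈) c) {u} {v} t eq lu qu lv qv =
    fromWitness {a? = edge? (toℕ u) (toℕ x)} (inj₁ (inj₁ (trans lx (cong suc (sym lu)) , s)))
      ∷ chain⇒path c (suc t) (proj₂ t<) lx qx (trans lv (+-suc t (length Ls))) qv
    where
    t< : t < depth × drop (suc t) layers ≡ Ls
    t< = drop-∷⇒< t layers eq
    x<n = encode<n {suc t} (proj₁ t<) q₁∈
    x : Fin n
    x = fromℕ< x<n
    lx : layer (toℕ x) ≡ suc t
    lx = trans (cong layer (toℕ-fromℕ< x<n)) (layer-encode (suc t) q₁∈)
    qx : label (toℕ x) ≡ q₁
    qx = trans (cong label (toℕ-fromℕ< x<n)) (label-encode (suc t) q₁∈)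
    s : StepIn (drop (layer (toℕ u)) layers) (label (toℕ u)) (label (toℕ x))
    s = subst₂ (StepIn (drop (layer (toℕ u)) layers)) (sym qu) (sym qx)
          (subst (λ Ls → StepIn Ls q q₁) (sym (trans (cong (λ t → drop t layers) lu) eq)) m)

  module _ (q q′ : Label) (q∈ : InRange q) (q′∈ : InRange q′) where

    source target : Fin n
    source = fromℕ< (encode<n {0} z≤n q∈)
    target = fromℕ< (encode<n {depth} ≤-refl q′∈)

    toℕ-source : toℕ source ≡ encode 0 q
    toℕ-source = toℕ-fromℕ< (encode<n {0} z≤n q∈)

    toℕ-target : toℕ target ≡ encode depth q′
    toℕ-target = toℕ-fromℕ< (encode<n {depth} ≤-refl q′∈)

    private
      ls : layer (toℕ source) ≡ 0
      ls = trans (cong layer toℕ-source) (layer-encode 0 q∈)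
      qs : label (toℕ source) ≡ q
      qs = trans (cong label toℕ-source) (label-encode 0 q∈)
      lt : layer (toℕ target) ≡ depth
      lt = trans (cong layer toℕ-target) (layer-encode depth q′∈)
      qt : label (toℕ target) ≡ q′
      qt = trans (cong label toℕ-target) (label-encode depth q′∈)

      excess : ∀ {ℓ} → Path source target ℓ → ∃[ b ] ℓ ≡ depth + 2 * b × (b ≡ 0 → Chain layers q q′)
      excess π with path⇒excess π (subst (_≤ depth) (sym ls) z≤n) lt
      ... | b , eq , chain rewrite ls | qs | qt = b , eq , chain

    chain⇒distance : Chain layers q q′ → IsDistance graph source target (just depth)
    chain⇒distance c = chain⇒path c 0 refl ls qs lt qt , λ ℓ π → shorter (excess π)
      where
      shorter : ∀ {ℓ} → (∃[ b ] ℓ ≡ depth + 2 * b × (b ≡ 0 → Chain layers q q′)) → depth ≤ ℓ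
      shorter (b , refl , _) = m≤m+n depth (2 * b)

    ¬chain⇒far : ¬ Chain layers q q′ → ∀ {ℓ} → Path source target ℓ → 2 + depth ≤ ℓ
    ¬chain⇒far ¬c π with excess π
    ... | zero  , _    , chain = contradiction (chain refl) ¬c
    ... | suc b , refl , _     = begin
      2 + depth              ≡⟨ +-comm 2 depth ⟩
      depth + 2              ≤⟨ +-monoʳ-≤ depth (*-monoʳ-≤ 2 (s≤s (z≤n {b}))) ⟩
      depth + 2 * suc b      ∎
      where open ≤-Reasoning

-- The switching network for set intersection

record Hosting (member : ℕ → ℕ → Bool) (N X r k n : ℕ) : Set where
  field
    graph          : Graph n
    r≤maxDegree    : r ≤ Graph.maxDegree graph
    maxDegree≤r+r  : Graph.maxDegree graph ≤ r + r
    offset         : ℕ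
    source target  : Fin N → Fin n
    toℕ-source     : ∀ i → toℕ (source i) ≡ toℕ i
    toℕ-target     : ∀ j → toℕ (target j) ≡ toℕ j + offset
    near           : ∀ i j {x} → x < X → T (member x (toℕ i)) → T (member x (toℕ j)) →
                     IsDistance graph (source i) (target j) (just k)
    far            : ∀ i j → ¬ (∃[ x ] T (member x (toℕ i)) × T (member x (toℕ j))) →
                     ∀ {ℓ} → Graph.Path graph (source i) (target j) ℓ → 2 + k ≤ ℓ

-- From the lowest digit up, an index `p` has one digit of radix `g`, `m` of radix `r` and one of
-- radix `g`; an element `y` has `suc h` digits of radix `e`. The weights `yw` and `pw` enter only
-- through their recursions.
module Switching (r e g h m : ℕ)
  {{r≢0 : NonZero r}} {{e≢0 : NonZero e}} {{g≢0 : NonZero g}} (e*g≤r : e * g ≤ r)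
  (yw pw : ℕ → ℕ) (yw≢0 : ∀ {s} → NonZero (yw s)) (pw≢0 : ∀ {s} → NonZero (pw s))
  (yw-0 : yw 0 ≡ 1) (yw-suc : ∀ s → yw (suc s) ≡ yw s * e)
  (pw-0 : pw 0 ≡ g) (pw-suc : ∀ s → pw (suc s) ≡ pw s * r)
  (member : ℕ → ℕ → Bool) where

  private
    instance
      _ = λ {s} → yw≢0 {s}
      _ = λ {s} → pw≢0 {s}

    e≤r : e * 1 ≤ r
    e≤r = ≤-trans (*-monoʳ-≤ e (>-nonZero⁻¹ g)) e*g≤r

  yLayer pLayer : ℕ → Layer r
  yLayer s = record
    { ylo = yw s ; ye = e ; plo = 1 ; pe = 1 ; fan = e≤r ; guard = λ _ _ → true }
  pLayer s = record
    { ylo = 1 ; ye = 1 ; plo = pw s ; pe = r ; fan = ≤-reflexive (*-identityˡ r) ; guard = λ _ _ → true }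

  -- The guards must see the complete element: `inLayer` tests it after its edge has written the
  -- last digit of `y`, `outLayer` before its edge erases that digit. The fan-out left over by `e`
  -- goes to the lowest and to the highest digit of `p`.
  inLayer outLayer : Layer r
  inLayer = record
    { ylo = yw h ; ye = e ; plo = 1 ; pe = g ; fan = e*g≤r
    ; guard = λ (_ , p) (y , _) → member y p }
  outLayer = record
    { ylo = yw h ; ye = e ; plo = pw m ; pe = g ; fan = e*g≤r
    ; guard = λ (y , _) (_ , p) → member y p }

  ups downs mids : ℕ → List (Layer r)
  ups zero      = []
  ups (suc s)   = ups s ++ yLayer s ∷ []
  downs zero    = []
  downs (suc s) = yLayer s ∷ downs s
  mids zero     = []
  mids (suc s)  = mids s ++ pLayer s ∷ []

  -- The element y is written digit by digit, its membership in the set i is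
  -- checked, i is overwritten by j, and y is erased again.
  layers : List (Layer r)
  layers = ups h ++ inLayer ∷ mids m ++ outLayer ∷ downs h

  length-layers : length layers ≡ h + suc (m + suc h)
  length-layers = begin
    length layers
      ≡⟨ length-++ (ups h) ⟩
    length (ups h) + suc (length (mids m ++ outLayer ∷ downs h))
      ≡⟨ cong (λ l → length (ups h) + suc l) (length-++ (mids m)) ⟩
    length (ups h) + suc (length (mids m) + suc (length (downs h)))
      ≡⟨ cong₂ (λ u l → u + suc l) (length-ups h) (cong₂ (λ a b → a + suc b) (length-mids m) (length-downs h)) ⟩
    h + suc (m + suc h) ∎
    where
    open ≡-Reasoning
    length-ups : ∀ s → length (ups s) ≡ s
    length-ups zero    = refl
    length-ups (suc s) = trans (length-++ (ups s)) (trans (+-comm _ 1) (cong suc (length-ups s)))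
    length-mids : ∀ s → length (mids s) ≡ s
    length-mids zero    = refl
    length-mids (suc s) = trans (length-++ (mids s)) (trans (+-comm _ 1) (cong suc (length-mids s)))
    length-downs : ∀ s → length (downs s) ≡ s
    length-downs zero    = refl
    length-downs (suc s) = cong suc (length-downs s)

  module Correctness (N X n : ℕ) {{N≢0 : NonZero N}}
    (X≤ : X ≤ yw (suc h)) (N≤ : N ≤ pw m * g)
    (room : suc (length layers) * yw (suc h) * (2 * N) + suc r ≤ n) where

    private
      instance
        2N≢0 : NonZero (2 * N)
        2N≢0 = m*n≢0 2 N

        pw*g≢0 : NonZero (pw m * g)
        pw*g≢0 = m*n≢0 (pw m) g

    open module Net = Network layers (yw (suc h)) (2 * N) n room

    initial : ∀ {i} → i < N → InRange (0 , i)
    initial i<N = >-nonZero⁻¹ (yw (suc h)) , <-≤-trans i<N (m≤n*m N 2)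

    complete : ∀ {x i j} → i < N → j < N → x < X → T (member x i) → T (member x j) →
      Chain layers (0 , i) (0 , j)
    complete {x} {i} {j} i<N j<N x<X x∈i x∈j =
      subst (λ y → Chain layers (y , i) (y , j)) Y₀
        (up h ++ᶜ (enter ∷ (mid m ++ᶜ (leave ∷ down h))))
      where
      -- `Y s` has the lowest `s` digits of `x` below zeros. Since `pw` starts at `g`, already `Q 0`
      -- has the lowest digit of `j`, and `Q s` has `s` digits of radix `r` more.
      Y Q : ℕ → ℕ
      Y s = splice (yw s) 0 x
      Q s = splice (pw s) i j
      Y₀ : Y 0 ≡ 0
      Y₀ = splice-≡1 0 x yw-0
      Yₕ : Y (suc h) ≡ x
      Yₕ = splice-≥ (>-nonZero⁻¹ (yw (suc h))) (<-≤-trans x<X X≤)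
      Y< : ∀ s → Y s < yw (suc h)
      Y< s = ≤-<-trans
        (≤-trans (≤-reflexive (cong (λ a → a * yw s + x % yw s) (0/n≡0 (yw s)))) (m%n≤m x (yw s)))
        (<-≤-trans x<X X≤)
      Q< : ∀ s → Q s < 2 * N
      Q< s = splice-< (pw s) i<N j<N
      p< : ∀ {p} → p < N → p < 2 * N
      p< p<N = <-≤-trans p<N (m≤n*m N 2)
      yAgree : ∀ s → Agree (yw s) e (Y s) (Y (suc s))
      yAgree s = splice-agree 0 x (yw-suc s)
      yAgree⁻ : ∀ s → Agree (yw s) e (Y (suc s)) (Y s)
      yAgree⁻ s = Agree-sym {yw s} {e} {z = Y s} {Y (suc s)} (yAgree s)
      up : ∀ s → Chain (ups s) (Y 0 , i) (Y s , i)
      up zero    = []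
      up (suc s) = up s ++ᶜ ((((yAgree s , (refl , refl)) , tt) , (Y< (suc s) , p< i<N)) ∷ [])
      down : ∀ s → Chain (downs s) (Y s , j) (Y 0 , j)
      down zero    = []
      down (suc s) = (((yAgree⁻ s , (refl , refl)) , tt) , (Y< s , p< j<N)) ∷ down s
      mid : ∀ s → Chain (mids s) (Y (suc h) , Q 0) (Y (suc h) , Q s)
      mid zero    = []
      mid (suc s) = mid s ++ᶜ
        (((((refl , refl) , splice-agree i j (pw-suc s)) , tt) , (Y< (suc h) , Q< (suc s))) ∷ [])
      enter : Layer.Move inLayer (Y h , i) (Y (suc h) , Q 0) × InRange (Y (suc h) , Q 0)
      enter = ((yAgree h , first) , subst (λ y → T (member y i)) (sym Yₕ) x∈i) , (Y< (suc h) , Q< 0)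
        where
        -- A splice at weight 1 is `i` itself, the index before any digit is overwritten.
        first : Agree 1 g i (Q 0)
        first = subst (λ a → Agree 1 g a (Q 0)) (splice-≡1 i j refl)
                  (splice-agree i j (trans pw-0 (sym (*-identityˡ g))))
      leave : Layer.Move outLayer (Y (suc h) , Q m) (Y h , j) × InRange (Y h , j)
      leave = ((yAgree⁻ h , last) , subst (λ y → T (member y j)) (sym Yₕ) x∈j) , (Y< h , p< j<N)
        where
        last : Agree (pw m) g (Q m) j
        last = subst (λ a → Agree (pw m) g (Q m) a) (splice-≥ (<-≤-trans i<N N≤) (<-≤-trans j<N N≤))
                 (splice-agree i j refl)

    -- The index is constant along `ups` and `downs`, and the element is constant along `mids`.
    -- Hence both guards test the same element, one against `i` and one against `j`.
    sound : ∀ {i j} → Chain layers (0 , i) (0 , j) → ∃[ x ] T (member x i) × T (member x j)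
    sound {i} {j} c = entered (split (ups h) c)
      where
      up : ∀ s {q q′} → Chain (ups s) q q′ → proj₂ q ≡ proj₂ q′
      up zero    []  = refl
      up (suc s) c with split (ups s) c
      ... | _ , c₁ , (((_ , a) , _) , _) ∷ [] = trans (up s c₁) (Agree-1-1⇒≡ a)
      down : ∀ s {q q′} → Chain (downs s) q q′ → proj₂ q ≡ proj₂ q′
      down zero    []  = refl
      down (suc s) ((((_ , a) , _) , _) ∷ c) = trans (Agree-1-1⇒≡ a) (down s c)
      mid : ∀ s {q q′} → Chain (mids s) q q′ → proj₁ q ≡ proj₁ q′
      mid zero    []  = refl
      mid (suc s) c with split (mids s) c
      ... | _ , c₁ , (((a , _) , _) , _) ∷ [] = trans (mid s c₁) (Agree-1-1⇒≡ a)
      left : ∀ {q q′} → Layer.Move inLayer q q′ →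
        ∃[ q″ ] Chain (mids m) q′ q″ × Chain (outLayer ∷ downs h) q″ (0 , j) →
        ∃[ x ] T (member x (proj₂ q)) × T (member x j)
      left {q} {q′} (_ , x∈) (q″ , c₁ , (((_ , x∈′) , _) ∷ c₂)) = proj₁ q″
        , subst (λ y → T (member y (proj₂ q))) (mid m c₁) x∈
        , subst (λ p → T (member (proj₁ q″) p)) (down h c₂) x∈′
      entered : ∃[ q ] Chain (ups h) (0 , i) q × Chain (inLayer ∷ mids m ++ outLayer ∷ downs h) q (0 , j) →
        ∃[ x ] T (member x i) × T (member x j)
      entered (q , c₁ , ((move , _) ∷ c₂)) =
        subst (λ p → ∃[ x ] T (member x p) × T (member x j)) (sym (up h c₁)) (left move (split (mids m) c₂))

    hosting : Hosting member N X r (length layers) n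
    hosting = record
      { graph         = graph
      ; r≤maxDegree   = r≤maxDegree
      ; maxDegree≤r+r = maxDegree≤ (>-nonZero⁻¹ r)
      ; offset        = depth * yw (suc h) * (2 * N)
      ; source        = src
      ; target        = tgt
      ; toℕ-source    = λ i → toℕ-source (0 , toℕ i) (0 , 0) (initial (toℕ<n i)) (initial 0<N)
      ; toℕ-target    = λ j → trans (toℕ-target (0 , 0) (0 , toℕ j) (initial 0<N) (initial (toℕ<n j)))
                                    (shuffle (depth * yw (suc h)) (2 * N) (toℕ j))
      ; near          = λ i j x<X x∈i x∈j →
          chain⇒distance (0 , toℕ i) (0 , toℕ j) (initial (toℕ<n i)) (initial (toℕ<n j))
            (complete (toℕ<n i) (toℕ<n j) x<X x∈i x∈j)
      ; far           = λ i j disjoint →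
          ¬chain⇒far (0 , toℕ i) (0 , toℕ j) (initial (toℕ<n i)) (initial (toℕ<n j))
            (λ c → disjoint (sound c))
      }
      where
      0<N : 0 < N
      0<N = >-nonZero⁻¹ N
      src tgt : Fin N → Fin n
      src i = source (0 , toℕ i) (0 , 0) (initial (toℕ<n i)) (initial 0<N)
      tgt j = target (0 , 0) (0 , toℕ j) (initial 0<N) (initial (toℕ<n j))
      shuffle : ∀ a b j → (a + 0) * b + j ≡ j + a * b
      shuffle = solve-∀

-- Word RAM programs

value-word : ∀ w {m} → m < 2 ^ w → value (word w m) ≡ m
value-word w m< = trans (toℕ-fromℕ< _) (m<n⇒m%n≡m {{m^n≢0 2 w}} m<)

fetch : Program → ℕ → Maybe Instr
fetch P p = head (drop p P)

step-just : ∀ {w} P (σ : State w) {i} → fetch P (State.pc σ) ≡ just i → step P σ ≡ exec i σ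
step-just P σ eq with head (drop (State.pc σ) P)
step-just P σ refl | just i = refl

-- Exact step counts make executions composable, whereas `run` only bounds the time from above.
data Trace {w} (P : Program) : ℕ → State w → State w → Set where
  []  : ∀ {σ} → Trace P 0 σ σ
  _∷_ : ∀ {t σ σ′ σ″} → step P σ ≡ just σ′ → Trace P t σ′ σ″ → Trace P (suc t) σ σ″

_++ᵗ_ : ∀ {w P s t} {σ σ′ σ″ : State w} → Trace P s σ σ′ → Trace P t σ′ σ″ → Trace P (s + t) σ σ″
[]      ++ᵗ d = d
(e ∷ c) ++ᵗ d = e ∷ (c ++ᵗ d)

run-halted : ∀ {w P} {σ : State w} t → step P σ ≡ nothing → run P t σ ≡ just σ
run-halted {P = P} {σ} t eq with step P σ
run-halted t refl | nothing = refl

run-step : ∀ {w} P t (σ : State w) {σ′} → step P σ ≡ just σ′ → run P (suc t) σ ≡ run P t σ′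
run-step P t σ eq with step P σ
run-step P t σ refl | just _ = refl

run⁺ : ∀ {w P s t} {σ σ′ : State w} → Trace P s σ σ′ → step P σ′ ≡ nothing → s ≤ t → run P t σ ≡ just σ′
run⁺ {t = t} []      halted _         = run-halted t halted
run⁺ {P = P} {t = suc t} {σ = σ} (e ∷ c) halted (s≤s s≤t) = trans (run-step P t σ e) (run⁺ c halted s≤t)

run⁻ : ∀ {w P} t {σ σ′ : State w} → run P t σ ≡ just σ′ →
  ∃[ s ] s ≤ t × Trace P s σ σ′ × step P σ′ ≡ nothing
run⁻ {P = P} t {σ} eq with step P σ in stepped
run⁻ t       refl | nothing = 0 , z≤n , [] , stepped
run⁻ (suc t) eq   | just σ₁ with run⁻ t eq
... | s , s≤t , c , halted = suc s , s≤s s≤t , stepped ∷ c , halted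

fetch-++ʳ : ∀ P {P′} p → fetch (P ++ P′) (length P + p) ≡ fetch P′ p
fetch-++ʳ []      p = refl
fetch-++ʳ (_ ∷ P) p = fetch-++ʳ P p

fetch-++ˡ : ∀ P {P′} p {i} → fetch P p ≡ just i → fetch (P ++ P′) p ≡ just i
fetch-++ˡ (_ ∷ P) zero    eq = eq
fetch-++ˡ (_ ∷ P) (suc p) eq = fetch-++ˡ P p eq

fetch-map : ∀ f P p {i} → fetch P p ≡ just i → fetch (map f P) p ≡ just (f i)
fetch-map f (_ ∷ P) zero    refl = refl
fetch-map f (_ ∷ P) (suc p) eq   = fetch-map f P p eq

fetch-just⇒< : ∀ P p {i} → fetch P p ≡ just i → p < length P
fetch-just⇒< (_ ∷ P) zero    eq = z<s
fetch-just⇒< (_ ∷ P) (suc p) eq = s≤s (fetch-just⇒< P p eq)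

fetch-nothing⇒≥ : ∀ P p → fetch P p ≡ nothing → length P ≤ p
fetch-nothing⇒≥ []      p       eq = z≤n
fetch-nothing⇒≥ (_ ∷ P) (suc p) eq = s≤s (fetch-nothing⇒≥ P p eq)

exec-nothing⇒halt : ∀ i {w} {σ : State w} → exec i σ ≡ nothing → i ≡ halt
exec-nothing⇒halt halt _ = refl

≡ᵇ-shift : ∀ k a b → (k + a ≡ᵇ k + b) ≡ (a ≡ᵇ b)
≡ᵇ-shift zero    a b = refl
≡ᵇ-shift (suc k) a b = ≡ᵇ-shift k a b

<⇒≡ᵇ-false : ∀ {a k} b → a < k → (a ≡ᵇ k + b) ≡ false
<⇒≡ᵇ-false {zero}  b (s≤s _)   = refl
<⇒≡ᵇ-false {suc a} b (s≤s a<k) = <⇒≡ᵇ-false b a<k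

≔-cong : ∀ {A : Set} {f g : ℕ → A} r {x y} → (∀ j → f j ≡ g j) → x ≡ y →
  ∀ j → (f [ r ≔ x ]) j ≡ (g [ r ≔ y ]) j
≔-cong r f≗g refl j with j ≡ᵇ r
... | true  = refl
... | false = f≗g j

-- P is moved by offset in the program and by gap in memory.  All its exits,
-- including jumps out of P, lead to the first instruction after it.
module Relocation (P : Program) (offset gap : ℕ) where

  label : ℕ → ℕ
  label ℓ = offset + (ℓ ⊓ length P)

  relocate : Instr → Instr
  relocate (imm r c)     = imm r c
  relocate (op o r a b)  = op o r a b
  relocate (load r a c)  = load r a (gap + c)
  relocate (store a c r) = store a (gap + c) r
  relocate (jmp ℓ)       = jmp (label ℓ)
  relocate (jlt a b ℓ)   = jlt a b (label ℓ)
  relocate halt          = jmp (label (length P))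

  -- The field `kept` lets the threshold in the private cells survive the execution of `P`.
  record Simulates {w} (saved : ℕ → Word w) (σ σ′ : State w) : Set where
    field
      pc≡   : State.pc σ′ ≡ label (State.pc σ)
      reg≡  : ∀ r → State.reg σ′ r ≡ State.reg σ r
      mem≡  : ∀ a → State.mem σ′ (gap + a) ≡ State.mem σ a
      kept  : ∀ {a} → a < gap → State.mem σ′ a ≡ saved a

  label-< : ∀ {p} → p < length P → label p ≡ offset + p
  label-< p< = cong (λ x → offset + x) (m≤n⇒m⊓n≡m (<⇒≤ p<))

  label-suc : ∀ {p q} → p < length P → q ≡ label p → suc q ≡ label (suc p)
  label-suc {p} p< refl = begin
    suc (label p)      ≡⟨ cong suc (label-< p<) ⟩
    suc (offset + p)   ≡⟨ +-suc offset p ⟨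
    offset + suc p     ≡⟨ cong (λ x → offset + x) (m≤n⇒m⊓n≡m p<) ⟨
    label (suc p)      ∎
    where open ≡-Reasoning

  gap-comm : ∀ v c → v + (gap + c) ≡ gap + (v + c)
  gap-comm v c = trans (sym (+-assoc v gap c)) (trans (cong (_+ c) (+-comm v gap)) (+-assoc gap v c))

  module _ {w} {saved : ℕ → Word w} where
    open Simulates

    exec-simulated : ∀ i {σ σ′ τ : State w} → State.pc σ < length P → Simulates saved σ σ′ →
      exec i σ ≡ just τ → ∃[ τ′ ] exec (relocate i) σ′ ≡ just τ′ × Simulates saved τ τ′
    exec-simulated (imm r c) p< S refl = _ , refl , record
      { pc≡ = label-suc p< (pc≡ S) ; reg≡ = ≔-cong r (reg≡ S) refl ; mem≡ = mem≡ S ; kept = kept S }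
    exec-simulated (op o r a b) p< S refl = _ , refl , record
      { pc≡ = label-suc p< (pc≡ S) ; reg≡ = ≔-cong r (reg≡ S) (cong₂ (eval o) (reg≡ S a) (reg≡ S b))
      ; mem≡ = mem≡ S ; kept = kept S }
    exec-simulated (load r a c) {σ} {σ′} p< S refl = _ , refl , record
      { pc≡ = label-suc p< (pc≡ S) ; reg≡ = ≔-cong r (reg≡ S) loaded ; mem≡ = mem≡ S ; kept = kept S }
      where
      loaded : State.mem σ′ (value (State.reg σ′ a) + (gap + c)) ≡ State.mem σ (value (State.reg σ a) + c)
      loaded = begin
        State.mem σ′ (value (State.reg σ′ a) + (gap + c))
          ≡⟨ cong (State.mem σ′) (gap-comm (value (State.reg σ′ a)) c) ⟩
        State.mem σ′ (gap + (value (State.reg σ′ a) + c))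
          ≡⟨ mem≡ S (value (State.reg σ′ a) + c) ⟩
        State.mem σ (value (State.reg σ′ a) + c)
          ≡⟨ cong (λ x → State.mem σ (value x + c)) (reg≡ S a) ⟩
        State.mem σ (value (State.reg σ a) + c) ∎
        where open ≡-Reasoning
    exec-simulated (store a c r) {state p R M} {state p′ R′ M′} p< S refl = _ , refl , record
      { pc≡ = label-suc p< (pc≡ S) ; reg≡ = reg≡ S ; mem≡ = stored ; kept = untouched }
      where
      address : value (R′ a) + (gap + c) ≡ gap + (value (R a) + c)
      address = trans (gap-comm (value (R′ a)) c) (cong (λ x → gap + (value x + c)) (reg≡ S a))
      stored : ∀ b → (M′ [ value (R′ a) + (gap + c) ≔ R′ r ]) (gap + b) ≡ (M [ value (R a) + c ≔ R r ]) b
      stored b rewrite address | ≡ᵇ-shift gap b (value (R a) + c) | reg≡ S r with b ≡ᵇ value (R a) + c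
      ... | true  = refl
      ... | false = mem≡ S b
      untouched : ∀ {b} → b < gap → (M′ [ value (R′ a) + (gap + c) ≔ R′ r ]) b ≡ saved b
      untouched b< rewrite address | <⇒≡ᵇ-false (value (R a) + c) b< = kept S b<
    exec-simulated (jmp ℓ) p< S refl = _ , refl , record
      { pc≡ = refl ; reg≡ = reg≡ S ; mem≡ = mem≡ S ; kept = kept S }
    exec-simulated (jlt a b ℓ) {state p R M} {state p′ R′ M′} p< S refl = _ , refl , record
      { pc≡ = jumped ; reg≡ = reg≡ S ; mem≡ = mem≡ S ; kept = kept S }
      where
      jumped : (if value (R′ a) <ᵇ value (R′ b) then label ℓ else suc p′) ≡
               label (if value (R a) <ᵇ value (R b) then ℓ else suc p)
      jumped rewrite reg≡ S a | reg≡ S b with value (R a) <ᵇ value (R b)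
      ... | true  = refl
      ... | false = label-suc p< (pc≡ S)

  module _ (pre post : Program) (pre-length : length pre ≡ offset) where

    relocated : Program
    relocated = pre ++ map relocate P ++ post

    fetch-relocated : ∀ {p i} → fetch P p ≡ just i → fetch relocated (offset + p) ≡ just (relocate i)
    fetch-relocated {p} eq = begin
      fetch relocated (offset + p)            ≡⟨ cong (λ o → fetch relocated (o + p)) pre-length ⟨
      fetch relocated (length pre + p)        ≡⟨ fetch-++ʳ pre p ⟩
      fetch (map relocate P ++ post) p        ≡⟨ fetch-++ˡ (map relocate P) p (fetch-map relocate P p eq) ⟩
      _                                       ∎
      where open ≡-Reasoning

    step-simulated : ∀ {w} {saved : ℕ → Word w} {σ σ′ τ} → Simulates saved σ σ′ → step P σ ≡ just τ →
      ∃[ τ′ ] step relocated σ′ ≡ just τ′ × Simulates saved τ τ′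
    step-simulated {σ = σ} {σ′} S eq with head (drop (State.pc σ) P) in fetched
    ... | just i with exec-simulated i p< S eq
      where p< = fetch-just⇒< P (State.pc σ) fetched
    ...   | τ′ , executed , S′ = τ′ , trans (step-just relocated σ′ at) executed , S′
      where
      at : fetch relocated (State.pc σ′) ≡ just (relocate i)
      at = trans (cong (fetch relocated)
                   (trans (Simulates.pc≡ S) (label-< (fetch-just⇒< P (State.pc σ) fetched))))
                 (fetch-relocated fetched)

    trace-simulated : ∀ {w} {saved : ℕ → Word w} {t σ σ′ τ} → Simulates saved σ σ′ → Trace P t σ τ →
      ∃[ τ′ ] Trace relocated t σ′ τ′ × Simulates saved τ τ′
    trace-simulated S [] = _ , [] , S
    trace-simulated S (e ∷ c) with step-simulated S e
    ... | σ₁ , e′ , S₁ with trace-simulated S₁ c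
    ...   | τ′ , c′ , S′ = τ′ , e′ ∷ c′ , S′

    -- Leaving `P` by running or jumping out of it is free, because `label` already points behind
    -- it; `halt` has become a jump and takes one step.
    halt-simulated : ∀ {w} {saved : ℕ → Word w} {σ σ′} → Simulates saved σ σ′ → step P σ ≡ nothing →
      ∃[ s ] s ≤ 1 × Trace relocated s σ′ (state (label (length P)) (State.reg σ′) (State.mem σ′))
    halt-simulated {σ = σ} {σ′} S eq with head (drop (State.pc σ) P) in fetched
    ... | nothing = 0 , z≤n ,
      subst (λ p → Trace relocated 0 σ′ (state p (State.reg σ′) (State.mem σ′))) pc′ []
      where
      pc′ : State.pc σ′ ≡ label (length P)
      pc′ = trans (Simulates.pc≡ S) (cong (λ x → offset + x)
              (trans (m≥n⇒m⊓n≡n (fetch-nothing⇒≥ P (State.pc σ) fetched)) (sym (⊓-idem (length P)))))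
    ... | just i with exec-nothing⇒halt i eq
    ...   | refl = 1 , s≤s z≤n , step-just relocated σ′ at ∷ []
      where
      at : fetch relocated (State.pc σ′) ≡ just (relocate halt)
      at = trans (cong (fetch relocated)
                   (trans (Simulates.pc≡ S) (label-< (fetch-just⇒< P (State.pc σ) fetched))))
                 (fetch-relocated fetched)

    run-simulated : ∀ {w} {saved : ℕ → Word w} {t σ σ′ τ} → Simulates saved σ σ′ → run P t σ ≡ just τ →
      ∃[ s ] ∃[ R ] ∃[ M ] s ≤ suc t × Trace relocated s σ′ (state (label (length P)) R M) ×
        (∀ r → R r ≡ State.reg τ r) × (∀ {a} → a < gap → M a ≡ saved a)
    run-simulated {t = t} S eq with run⁻ t eq
    ... | s , s≤t , c , halted with trace-simulated S c
    ...   | τ′ , c′ , S′ with halt-simulated S′ halted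
    ...     | s′ , s′≤1 , c″ = s + s′ , State.reg τ′ , State.mem τ′ ,
              ≤-trans (+-mono-≤ s≤t s′≤1) (≤-reflexive (+-comm t 1)) , c′ ++ᵗ c″ ,
              Simulates.reg≡ S′ , Simulates.kept S′

-- The cell c₀ is zero if queries are answered by P, and the number of sets if
-- they are answered from a table.  In the first case c₁ is added to the second
-- query and c₂ is the threshold for the estimate.
record Wrapping (P : Program) : Set where
  field
    wrapped    : Program
    run-oracle : ∀ {w} → 1 < 2 ^ w → ∀ {c₀ c₁ c₂ : Word w} {rest} x y {t τ} → value c₀ ≡ 0 →
      run P t (state 0 (inputs x (word w (value y + value c₁))) (contents rest)) ≡ just τ →
      ∃[ σ ] run wrapped (11 + t) (state 0 (inputs x y) (contents (c₀ ∷ c₁ ∷ c₂ ∷ rest))) ≡ just σ ×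
        value (State.reg σ 0) ≡ (if value (State.reg τ 0) <ᵇ value c₂ then 1 else 0)
    run-table  : ∀ {w} → 1 < 2 ^ w → ∀ {c₀ c₁ c₂ : Word w} {rest} x y t {N} → value c₀ ≡ suc N →
      value x * suc N + value y < 2 ^ w →
      ∃[ σ ] run wrapped (11 + t) (state 0 (inputs x y) (contents (c₀ ∷ c₁ ∷ c₂ ∷ rest))) ≡ just σ ×
        State.reg σ 0 ≡ contents rest (value x * suc N + value y)

module Wrapper (P : Program) where

  end table : ℕ
  end = 5 + length P
  table = 7 + end

  -- Registers 2 and 3 start at zero, so register 2 can be the base of its own load. If the flag it
  -- receives is zero, it is a valid base again, and it is cleared before `P` starts from what must
  -- look like an initial state. Otherwise it holds the number of sets, the row length of the table,
  -- which begins behind the three private cells.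
  before after : Program
  before =
    load 2 2 0 ∷
    jlt 3 2 table ∷
    load 2 2 1 ∷
    op add 1 1 2 ∷
    imm 2 0 ∷ []
  after =
    imm 1 0 ∷
    load 1 1 2 ∷
    jlt 0 1 (5 + end) ∷
    imm 0 0 ∷
    halt ∷
    imm 0 1 ∷
    halt ∷
    op mul 0 0 2 ∷
    op add 0 0 1 ∷
    load 0 0 3 ∷
    halt ∷ []

  module R = Relocation P 5 3

  wrapped : Program
  wrapped = R.relocated before after refl

  fetch-after : ∀ k → fetch wrapped (k + end) ≡ fetch after k
  fetch-after k = begin
    fetch wrapped (k + end)
      ≡⟨ cong (fetch wrapped) (trans (+-comm k end) (+-assoc 5 (length P) k)) ⟩
    fetch (map R.relocate P ++ after) (length P + k)
      ≡⟨ cong (λ l → fetch (map R.relocate P ++ after) (l + k)) (sym (length-map R.relocate P)) ⟩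
    fetch (map R.relocate P ++ after) (length (map R.relocate P) + k)
      ≡⟨ fetch-++ʳ (map R.relocate P) k ⟩
    fetch after k ∎
    where open ≡-Reasoning

  at : ∀ {w} k {i} {R M : ℕ → Word w} → fetch after k ≡ just i →
    step wrapped (state (k + end) R M) ≡ exec i (state (k + end) R M)
  at k {R = R} {M} eq = step-just wrapped (state (k + end) R M) (trans (fetch-after k) eq)

  module _ {w : ℕ} (1<2^w : 1 < 2 ^ w) where

    value-0 : value (word w 0) ≡ 0
    value-0 = value-word w (<-trans z<s 1<2^w)

    value-1 : value (word w 1) ≡ 1
    value-1 = value-word w 1<2^w

    threshold : ∀ (R M : ℕ → Word w) → ∃[ σ ] ∃[ s ] s ≤ 5 × Trace wrapped s (state end R M) σ ×
      step wrapped σ ≡ nothing ×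
      value (State.reg σ 0) ≡ (if value (R 0) <ᵇ value (M 2) then 1 else 0)
    threshold R M = branch (value (R 0) <ᵇ value (M 2)) refl
      where
      R₂ : ℕ → Word w
      R₂ = (R [ 1 ≔ word w 0 ]) [ 1 ≔ M (value (word w 0) + 2) ]
      test : ∀ {b} → (value (R 0) <ᵇ value (M 2)) ≡ b →
        step wrapped (state (2 + end) R₂ M) ≡ just (state (if b then 5 + end else 3 + end) R₂ M)
      test eq = trans (at 2 refl) (cong (λ b → just (state (if b then 5 + end else 3 + end) R₂ M))
        (trans (cong (λ v → value (R 0) <ᵇ value (M (v + 2))) value-0) eq))
      branch : ∀ b → (value (R 0) <ᵇ value (M 2)) ≡ b → ∃[ σ ] ∃[ s ] s ≤ 5 ×
        Trace wrapped s (state end R M) σ × step wrapped σ ≡ nothing ×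
        value (State.reg σ 0) ≡ (if b then 1 else 0)
      branch true eq = _ , 4 , s≤s (s≤s (s≤s (s≤s z≤n))) ,
        at 0 refl ∷ at 1 refl ∷ test eq ∷ at 5 refl ∷ [] , at 6 refl , value-1
      branch false eq = _ , 4 , s≤s (s≤s (s≤s (s≤s z≤n))) ,
        at 0 refl ∷ at 1 refl ∷ test eq ∷ at 3 refl ∷ [] , at 4 refl , value-0

    module _ {c₀ c₁ c₂ : Word w} {rest : List (Word w)} (x y : Word w) where

      private
        M : ℕ → Word w
        M = contents (c₀ ∷ c₁ ∷ c₂ ∷ rest)
        R₁ : ℕ → Word w
        R₁ = inputs x y [ 2 ≔ M (value (word w 0) + 0) ]
        loaded : R₁ 2 ≡ c₀
        loaded = cong (λ v → M (v + 0)) value-0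
        test : ∀ {b} → (0 <ᵇ value c₀) ≡ b →
          step wrapped (state 1 R₁ M) ≡ just (state (if b then table else 2) R₁ M)
        test eq = cong (λ b → just (state (if b then table else 2) R₁ M))
          (trans (cong₂ _<ᵇ_ value-0 (cong value loaded)) eq)

      run-oracle : ∀ {t τ} → value c₀ ≡ 0 →
        run P t (state 0 (inputs x (word w (value y + value c₁))) (contents rest)) ≡ just τ →
        ∃[ σ ] run wrapped (11 + t) (state 0 (inputs x y) M) ≡ just σ ×
          value (State.reg σ 0) ≡ (if value (State.reg τ 0) <ᵇ value c₂ then 1 else 0)
      run-oracle {t} {τ} c₀≡0 ran = finish (R.run-simulated before after refl simulates ran)
        where
        R₃ R₄ R₅ : ℕ → Word w
        R₃ = R₁ [ 2 ≔ M (value (R₁ 2) + 1) ]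
        R₄ = R₃ [ 1 ≔ eval add (R₃ 1) (R₃ 2) ]
        R₅ = R₄ [ 2 ≔ word w 0 ]
        prelude : Trace wrapped 5 (state 0 (inputs x y) M) (state 5 R₅ M)
        prelude = refl ∷ test (cong (0 <ᵇ_) c₀≡0) ∷ refl ∷ refl ∷ refl ∷ []
        offset : R₃ 2 ≡ c₁
        offset = cong (λ v → M (v + 1)) (trans (cong value loaded) c₀≡0)
        simulates : R.Simulates M (state 0 (inputs x (word w (value y + value c₁))) (contents rest))
                                  (state 5 R₅ M)
        simulates = record { pc≡ = refl ; reg≡ = regs ; mem≡ = λ _ → refl ; kept = λ _ → refl }
          where
          regs : ∀ r → R₅ r ≡ inputs x (word w (value y + value c₁)) r
          regs 0 = refl
          regs 1 = cong (λ c → word w (value y + value c)) offset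
          regs 2 = refl
          regs (suc (suc (suc r))) = refl
        finish : ∃[ s ] ∃[ R ] ∃[ M′ ] s ≤ suc t ×
          Trace wrapped s (state 5 R₅ M) (state (R.label (length P)) R M′) ×
          (∀ r → R r ≡ State.reg τ r) × (∀ {a} → a < 3 → M′ a ≡ M a) → _
        finish (s , R , M′ , s≤ , c , regs , kept) with threshold R M′
        ... | σ , s′ , s′≤ , c′ , halted , outcome = σ ,
          run⁺ (prelude ++ᵗ (c ++ᵗ subst (λ p → Trace wrapped s′ (state p R M′) σ) end≡ c′)) halted
            -- Five steps before `P`, at most `suc t` in its relocated copy and at most five for the
            -- comparison: this is the origin of `11 + t`.
            (≤-trans (+-monoʳ-≤ 5 (+-mono-≤ s≤ s′≤)) (≤-reflexive (cong (λ x → 6 + x) (+-comm t 5)))) ,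
          trans outcome (cong₂ (λ a b → if value a <ᵇ value b then 1 else 0) (regs 0) (kept (s≤s (s≤s (s≤s z≤n)))))
          where
          end≡ : end ≡ R.label (length P)
          end≡ = cong (λ x → 5 + x) (sym (⊓-idem (length P)))

      run-table : ∀ t {N} → value c₀ ≡ suc N → value x * suc N + value y < 2 ^ w →
        ∃[ σ ] run wrapped (11 + t) (state 0 (inputs x y) M) ≡ just σ ×
          State.reg σ 0 ≡ contents rest (value x * suc N + value y)
      run-table t {N} c₀≡ small = state (10 + end) R₄ M ,
        run⁺ lookup (at 10 refl) (≤-trans (s≤s (s≤s (s≤s (s≤s (s≤s z≤n))))) (m≤m+n 11 t)) ,
        trans (cong (λ v → M (v + 3)) index) (cong M (+-comm (value x * suc N + value y) 3))
        where
        R₂ R₃ R₄ : ℕ → Word w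
        R₂ = R₁ [ 0 ≔ eval mul (R₁ 0) (R₁ 2) ]
        R₃ = R₂ [ 0 ≔ eval add (R₂ 0) (R₂ 1) ]
        R₄ = R₃ [ 0 ≔ M (value (R₃ 0) + 3) ]
        lookup : Trace wrapped 5 (state 0 (inputs x y) M) (state (10 + end) R₄ M)
        lookup = refl ∷ test (cong (0 <ᵇ_) c₀≡) ∷ at 7 refl ∷ at 8 refl ∷ at 9 refl ∷ []
        product : value (eval mul x (R₁ 2)) ≡ value x * suc N
        product = trans (cong (λ v → value (word w (value x * v))) (trans (cong value loaded) c₀≡))
                        (value-word w (≤-<-trans (m≤m+n (value x * suc N) (value y)) small))
        index : value (eval add (eval mul x (R₁ 2)) y) ≡ value x * suc N + value y
        index = trans (cong (λ v → value (word w (v + value y))) product) (value-word w small)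

abstract
  wrapping : ∀ P → Wrapping P
  wrapping P = record { wrapped = wrapped ; run-oracle = run-oracle ; run-table = run-table }
    where open Wrapper P

-- Logarithms, roots and the choice of radices

n<2^[1+⌊log₂n⌋] : ∀ n → n < 2 ^ suc ⌊log₂ n ⌋
n<2^[1+⌊log₂n⌋] n = ≰⇒> λ 2^≤n → <-irrefl refl
  (subst (_≤ ⌊log₂ n ⌋) (⌊log₂[2^n]⌋≡n (suc ⌊log₂ n ⌋)) (⌊log₂⌋-mono-≤ 2^≤n))

⌊n/2⌋<m : ∀ {n m} → n < 2 * m → ⌊ n /2⌋ < m
⌊n/2⌋<m {n} {m} n<2m = *-cancelˡ-< 2 ⌊ n /2⌋ m (begin-strict
  2 * ⌊ n /2⌋            ≡⟨ cong (λ x → ⌊ n /2⌋ + x) (+-identityʳ ⌊ n /2⌋) ⟩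
  ⌊ n /2⌋ + ⌊ n /2⌋      ≤⟨ +-monoʳ-≤ ⌊ n /2⌋ (⌊n/2⌋≤⌈n/2⌉ n) ⟩
  ⌊ n /2⌋ + ⌈ n /2⌉      ≡⟨ ⌊n/2⌋+⌈n/2⌉≡n n ⟩
  n                      <⟨ n<2m ⟩
  2 * m                  ∎)
  where open ≤-Reasoning

n<2^[1+m]⇒⌊log₂n⌋≤m : ∀ m {n} → n < 2 ^ suc m → ⌊log₂ n ⌋ ≤ m
n<2^[1+m]⇒⌊log₂n⌋≤m zero    {zero}        _             = z≤n
n<2^[1+m]⇒⌊log₂n⌋≤m zero    {suc zero}    _             = z≤n
n<2^[1+m]⇒⌊log₂n⌋≤m zero    {suc (suc n)} (s≤s (s≤s ()))
n<2^[1+m]⇒⌊log₂n⌋≤m (suc m) {n}           n<            = m∸n≤o⇒m≤n+o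
  (subst (_≤ m) (⌊log₂⌊n/2⌋⌋≡⌊log₂n⌋∸1 n) (n<2^[1+m]⇒⌊log₂n⌋≤m m (⌊n/2⌋<m n<)))
  where
  m∸n≤o⇒m≤n+o : ∀ {a} → a ∸ 1 ≤ m → a ≤ suc m
  m∸n≤o⇒m≤n+o {zero}  _  = z≤n
  m∸n≤o⇒m≤n+o {suc a} le = s≤s le

2^⌊log₂n⌋≤n : ∀ n → 1 ≤ n → 2 ^ ⌊log₂ n ⌋ ≤ n
2^⌊log₂n⌋≤n n 1≤n with ⌊log₂ n ⌋ in eq
... | zero  = 1≤n
... | suc m = ≮⇒≥ λ n< → <-irrefl refl
  (subst (_≤ m) eq (n<2^[1+m]⇒⌊log₂n⌋≤m m n<))

n<2^n : ∀ n → n < 2 ^ n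
n<2^n zero    = z<s
n<2^n (suc n) = begin-strict
  suc n            <⟨ s≤s (n<2^n n) ⟩
  suc (2 ^ n)      ≤⟨ +-monoˡ-≤ (2 ^ n) (m^n>0 2 n) ⟩
  2 ^ n + 2 ^ n    ≡⟨ cong (λ x → 2 ^ n + x) (sym (+-identityʳ (2 ^ n))) ⟩
  2 ^ suc n        ∎
  where open ≤-Reasoning

^-distribʳ-* : ∀ m n k → (m * n) ^ k ≡ m ^ k * n ^ k
^-distribʳ-* m n zero    = refl
^-distribʳ-* m n (suc k) = trans (cong (m * n *_) (^-distribʳ-* m n k)) (interchange m n (m ^ k) (n ^ k))
  where
  interchange : ∀ a b c d → a * b * (c * d) ≡ a * c * (b * d)
  interchange = solve-∀

-- Write n < D (q + 1) ≤ D 2^q with q = ⌊n / D⌋ and raise to the power D = c + 1.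
n^c≤2^n : ∀ c {n} → suc c ^ suc c ≤ n → n ^ c ≤ 2 ^ n
n^c≤2^n c {n} D^D≤n = *-cancelˡ-≤ (D ^ D) {{m^n≢0 D D}} (begin
  D ^ D * n ^ c          ≤⟨ *-monoˡ-≤ (n ^ c) D^D≤n ⟩
  n ^ D                  ≤⟨ ^-monoˡ-≤ D n≤ ⟩
  (D * 2 ^ (n / D)) ^ D  ≡⟨ ^-distribʳ-* D (2 ^ (n / D)) D ⟩
  D ^ D * (2 ^ (n / D)) ^ D  ≡⟨ cong (D ^ D *_) (^-*-assoc 2 (n / D) D) ⟩
  D ^ D * 2 ^ (n / D * D)    ≤⟨ *-monoʳ-≤ (D ^ D) (^-monoʳ-≤ 2 (m/n*n≤m n D)) ⟩
  D ^ D * 2 ^ n          ∎)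
  where
  open ≤-Reasoning
  D = suc c
  n≤ : n ≤ D * 2 ^ (n / D)
  n≤ = begin
    n                      ≡⟨ m≡m%n+[m/n]*n n D ⟩
    n % D + (n / D) * D    ≤⟨ +-monoˡ-≤ ((n / D) * D) (m%n≤n n D) ⟩
    suc (n / D) * D        ≡⟨ *-comm (suc (n / D)) D ⟩
    D * suc (n / D)        ≤⟨ *-monoʳ-≤ D (n<2^n (n / D)) ⟩
    D * 2 ^ (n / D)        ∎

2^m≤n⇒m≤⌊log₂n⌋ : ∀ m {n} → 2 ^ m ≤ n → m ≤ ⌊log₂ n ⌋
2^m≤n⇒m≤⌊log₂n⌋ m 2^m≤n = subst (_≤ _) (⌊log₂[2^n]⌋≡n m) (⌊log₂⌋-mono-≤ 2^m≤n)

⌊log₂n⌋^c≤n : ∀ c {n} → 2 ^ (suc c ^ suc c) ≤ n → ⌊log₂ n ⌋ ^ c ≤ n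
⌊log₂n⌋^c≤n c {n} large = ≤-trans
  (n^c≤2^n c (2^m≤n⇒m≤⌊log₂n⌋ (suc c ^ suc c) large))
  (2^⌊log₂n⌋≤n n (≤-trans (m^n>0 2 (suc c ^ suc c)) large))

m≤m^k : ∀ m k .{{_ : NonZero k}} → m ≤ m ^ k
m≤m^k zero    k       = z≤n
m≤m^k (suc m) (suc k) = m≤m*n (suc m) (suc m ^ k) {{m^n≢0 (suc m) k}}

root : ∀ k .{{_ : NonZero k}} {n} → 1 ≤ n → ∃[ t ] t ^ k < n × n ≤ suc t ^ k
root k@(suc _) {n} 1≤n = search n (m≤m^k n k)
  where
  search : ∀ s → n ≤ s ^ k → ∃[ t ] t ^ k < n × n ≤ suc t ^ k
  search zero    n≤0 = contradiction n≤0 (<⇒≱ 1≤n)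
  search (suc s) n≤ with n ≤? s ^ k
  ... | yes n≤s^k = search s n≤s^k
  ... | no  n≰s^k = s , ≰⇒> n≰s^k , n≤

ceilLog : ∀ {r x} → 2 ≤ r → 2 ≤ x → ∃[ h ] r ^ h < x × x ≤ r ^ suc h
ceilLog {r} {x} 2≤r 2≤x = search x (≤-trans (<⇒≤ (n<2^n x)) (^-monoˡ-≤ x 2≤r))
  where
  search : ∀ s → x ≤ r ^ s → ∃[ h ] r ^ h < x × x ≤ r ^ suc h
  search zero    x≤1 = contradiction x≤1 (<⇒≱ 2≤x)
  search (suc s) x≤ with x ≤? r ^ s
  ... | yes x≤r^s = search s x≤r^s
  ... | no  x≰r^s = s , ≰⇒> x≰r^s , x≤

-- `k≡` repeats the length of the switching network: `suc h` edges write the element, `suc h` erase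
-- it, `m` lie between. `e^[1+h]≤` limits the number of vertices, which must include every number of
-- `suc h` digits and not only those below `X`.
record Radices (k X N r : ℕ) : Set where
  field
    e g h m  : ℕ
    {{e≢0}}  : NonZero e
    {{g≢0}}  : NonZero g
    e*g≤r    : e * g ≤ r
    k≡       : k ≡ h + suc (m + suc h)
    X≤       : X ≤ e ^ suc h
    e^[1+h]≤ : e ^ suc h ≤ X * X
    N≤       : N ≤ g * r ^ m * g

-- If r ≥ X, one step suffices to write an element, and its fan-out r leaves
-- room for a digit of radix ⌊r / X⌋; otherwise the element is written in base r.
radices : ∀ {k X N r n} → 2 ≤ k → 2 ≤ X → 2 ≤ r → 1 ≤ N →
  n ≤ r ^ k → N * (X * X * (X * X)) ≤ n → Radices k X N r
radices {suc (suc k)} {X} {N} {r} {n} (s≤s (s≤s _)) 2≤X 2≤r 1≤N n≤ NX⁴≤n with X ≤? r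
... | yes X≤r = record
  { e = X ; g = g ; h = 0 ; m = k ; e*g≤r = ≤-trans (≤-reflexive (*-comm X g)) (m/n*n≤m r X)
  ; k≡ = cong suc (+-comm 1 k) ; X≤ = ≤-reflexive (sym (*-identityʳ X))
  ; e^[1+h]≤ = *-monoʳ-≤ X (≤-trans (s≤s z≤n) 2≤X)
  -- Only the two end layers lose reach: each uses radix `g` in place of `r ≤ g * (X * X)`, a total
  -- loss of X^4.
  ; N≤ = *-cancelʳ-≤ N (g * r ^ k * g) (X * X * (X * X)) (begin
      N * (X * X * (X * X))                 ≤⟨ NX⁴≤n ⟩
      n                                     ≤⟨ n≤ ⟩
      r * (r * r ^ k)                       ≤⟨ *-mono-≤ r≤ (*-monoˡ-≤ (r ^ k) r≤) ⟩
      g * (X * X) * (g * (X * X) * r ^ k)   ≡⟨ shuffle g (X * X) (r ^ k) ⟩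
      g * r ^ k * g * (X * X * (X * X))     ∎)
  }
  where
  open ≤-Reasoning
  instance
    X≢0 : NonZero X
    X≢0 = >-nonZero (≤-trans (s≤s z≤n) 2≤X)
    X²≢0 : NonZero (X * X)
    X²≢0 = m*n≢0 X X
    X⁴≢0 : NonZero (X * X * (X * X))
    X⁴≢0 = m*n≢0 (X * X) (X * X)
  g = r / X
  1≤g : 1 ≤ g
  1≤g = m≥n⇒m/n>0 X≤r
  instance
    g≢0 : NonZero g
    g≢0 = >-nonZero 1≤g
  shuffle : ∀ g x p → g * x * (g * x * p) ≡ g * p * g * (x * x)
  shuffle = solve-∀
  -- Rounding in `g = r / X` costs a factor of 2, which is at most `X`.
  r≤ : r ≤ g * (X * X)
  r≤ = begin
    r              ≡⟨ m≡m%n+[m/n]*n r X ⟩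
    r % X + g * X  ≤⟨ +-monoˡ-≤ (g * X) (m%n≤n r X) ⟩
    X + g * X      ≤⟨ +-monoˡ-≤ (g * X) (m≤n*m X g) ⟩
    g * X + g * X  ≡⟨ double (g * X) ⟩
    g * X * 2      ≤⟨ *-monoʳ-≤ (g * X) 2≤X ⟩
    g * X * X      ≡⟨ *-assoc g X X ⟩
    g * (X * X)    ∎
    where
    double : ∀ a → a + a ≡ a * 2
    double = solve-∀
... | no X≰r with ceilLog 2≤r 2≤X
...   | h , r^h<X , X≤r^[1+h] = record
  { e = r ; g = 1 ; h = h ; m = m ; e*g≤r = ≤-reflexive (*-identityʳ r)
  ; k≡ = k≡ ; X≤ = X≤r^[1+h]
  ; e^[1+h]≤ = r^[1+h]≤
  ; N≤ = ≤-trans (*-cancelʳ-≤ N (r ^ m) (X * X * (X * X)) (begin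
      N * (X * X * (X * X))               ≤⟨ NX⁴≤n ⟩
      n                                   ≤⟨ n≤ ⟩
      r ^ K                               ≡⟨ cong (r ^_) (sym (m+[n∸m]≡n fits)) ⟩
      r ^ (suc h + suc h + m)             ≡⟨ ^-distribˡ-+-* r (suc h + suc h) m ⟩
      r ^ (suc h + suc h) * r ^ m         ≤⟨ *-monoˡ-≤ (r ^ m) r^2[1+h]≤ ⟩
      X * X * (X * X) * r ^ m             ≡⟨ *-comm (X * X * (X * X)) (r ^ m) ⟩
      r ^ m * (X * X * (X * X))           ∎))
      (≤-reflexive (trans (sym (*-identityʳ (r ^ m))) (cong (_* 1) (sym (+-identityʳ (r ^ m))))))
  }
  where
  open ≤-Reasoning
  K = suc (suc k)
  instance
    r≢0 : NonZero r
    r≢0 = >-nonZero (≤-trans (s≤s z≤n) 2≤r)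
    X≢0 : NonZero X
    X≢0 = >-nonZero (≤-trans (s≤s z≤n) 2≤X)
    X²≢0 : NonZero (X * X)
    X²≢0 = m*n≢0 X X
    X⁴≢0 : NonZero (X * X * (X * X))
    X⁴≢0 = m*n≢0 (X * X) (X * X)
  r^[1+h]< : r ^ suc h < X * X
  r^[1+h]< = begin-strict
    r * r ^ h   <⟨ *-monoʳ-< r r^h<X ⟩
    r * X       ≤⟨ *-monoˡ-≤ X (<⇒≤ (≰⇒> X≰r)) ⟩
    X * X       ∎
  r^[1+h]≤ = <⇒≤ r^[1+h]<
  r^2[1+h]< : r ^ (suc h + suc h) < X * X * (X * X)
  r^2[1+h]< = begin-strict
    r ^ (suc h + suc h)       ≡⟨ ^-distribˡ-+-* r (suc h) (suc h) ⟩
    r ^ suc h * r ^ suc h     <⟨ *-mono-< r^[1+h]< r^[1+h]< ⟩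
    X * X * (X * X)           ∎
  r^2[1+h]≤ = <⇒≤ r^2[1+h]<
  -- Were `K` too short for writing and erasing, `n ≤ r ^ K` would be below X^4, because
  -- `r ^ suc h < r * X ≤ X * X`.
  fits : suc h + suc h ≤ K
  fits = ≮⇒≥ λ K< → <-irrefl refl (begin-strict
    n                        ≤⟨ n≤ ⟩
    r ^ K                    ≤⟨ ^-monoʳ-≤ r (<⇒≤ K<) ⟩
    r ^ (suc h + suc h)      <⟨ r^2[1+h]< ⟩
    X * X * (X * X)          ≤⟨ m≤n*m (X * X * (X * X)) N {{>-nonZero 1≤N}} ⟩
    N * (X * X * (X * X))    ≤⟨ NX⁴≤n ⟩
    n                        ∎)
  m = K ∸ (suc h + suc h)
  k≡ : K ≡ h + suc (m + suc h)
  k≡ = trans (sym (m+[n∸m]≡n fits)) (shuffle h m)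
    where
    shuffle : ∀ h m → suc h + suc h + m ≡ h + suc (m + suc h)
    shuffle = solve-∀

-- The numbers of `source` and `target` are explicit because the query program has to compute them:
-- the first query passes unchanged, and the second is shifted by the stored `offset`.
record Gadget (k : ℕ → ℕ) (n : ℕ) {N U} (S : Fin N → Subset U) : Set where
  field
    graph          : Graph n
    degrees        : MaxDegreeΘRoot 1 4 k graph
    offset         : ℕ
    source target  : Fin N → Fin n
    toℕ-source     : ∀ i → toℕ (source i) ≡ toℕ i
    toℕ-target     : ∀ j → toℕ (target j) ≡ toℕ j + offset
    near           : ∀ i j → Nonempty (S i ∩ S j) → IsDistance graph (source i) (target j) (just (k n))
    far            : ∀ i j → ¬ Nonempty (S i ∩ S j) →
                     ∀ {ℓ} → Graph.Path graph (source i) (target j) ℓ → 2 + k n ≤ ℓ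

module Membership {N U} (S : Fin N → Subset U) where

  Member : ℕ → ℕ → Set
  Member y p = ∃[ x ] ∃[ i ] toℕ {U} x ≡ y × toℕ {N} i ≡ p × x ∈ S i

  member? : ∀ y p → Dec (Member y p)
  member? y p = any? λ x → any? λ i → (toℕ x ≟ y) ×-dec ((toℕ i ≟ p) ×-dec (x ∈? S i))

  member : ℕ → ℕ → Bool
  member y p = ⌊ member? y p ⌋

  member⁺ : ∀ {x i} → x ∈ S i → T (member (toℕ x) (toℕ i))
  member⁺ {x} {i} x∈ = fromWitness {a? = member? (toℕ x) (toℕ i)} (x , i , refl , refl , x∈)

  member⁻ : ∀ {y i} → T (member y (toℕ i)) → ∃[ x ] toℕ x ≡ y × x ∈ S i
  member⁻ {y} {i} t with toWitness {a? = member? y (toℕ i)} t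
  ... | x , i′ , x≡ , i≡ , x∈ = x , x≡ , subst (λ i → x ∈ S i) (toℕ-injective i≡) x∈

  common⁻ : ∀ {i j} → ∃[ y ] T (member y (toℕ i)) × T (member y (toℕ j)) → Nonempty (S i ∩ S j)
  common⁻ {i} {j} (y , y∈i , y∈j) with member⁻ y∈i | member⁻ y∈j
  ... | x , x≡ , x∈i | x′ , x′≡ , x′∈j =
    x , x∈p∩q⁺ (x∈i , subst (_∈ S j) (toℕ-injective (trans x′≡ (sym x≡))) x′∈j)

-- With `r = suc t`, the star takes at most half of the vertices and leaves the other half to the
-- layers. Small `t` rely on `8 ≤ n`, larger ones on `t * t < n`.
2[1+r]≤n : ∀ {t k n} → 2 ≤ k → 8 ≤ n → t ^ k < n → suc (suc t) * 2 ≤ n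
2[1+r]≤n {t} {suc (suc k)} {n} (s≤s (s≤s _)) 8≤n t^k<n with t ≤? 2
... | yes t≤2 = ≤-trans (*-monoˡ-≤ 2 (s≤s (s≤s t≤2))) 8≤n
... | no  t≰2 = begin
  suc (suc t) * 2      ≡⟨ shuffle t ⟩
  suc (2 * t + 3)      ≤⟨ s≤s (+-monoʳ-≤ (2 * t) 3≤t) ⟩
  suc (2 * t + t)      ≡⟨ cong suc (+-comm (2 * t) t) ⟩
  suc (3 * t)          ≤⟨ s≤s (*-monoˡ-≤ t 3≤t) ⟩
  suc (t * t)          ≤⟨ s≤s (*-monoʳ-≤ t (m≤m^k t (suc k))) ⟩
  suc (t ^ suc (suc k)) ≤⟨ t^k<n ⟩
  n                    ∎
  where
  open ≤-Reasoning
  3≤t = ≰⇒> t≰2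
  shuffle : ∀ t → suc (suc t) * 2 ≡ suc (2 * t + 3)
  shuffle = solve-∀

networkHosting : ∀ {k N X r n} member → Radices k X N r → 1 ≤ N → 1 ≤ r →
  suc k * (X * X) * (2 * N) + suc r ≤ n → Hosting member N X r k n
networkHosting {k} {N} {X} {r} {n} member R 1≤N 1≤r room = subst (λ d → Hosting member N X r d n) depth≡
  (Correctness.hosting N X n {{>-nonZero 1≤N}} X≤ N≤ room′)
  where
  open Radices R
  r≢0 : NonZero r
  r≢0 = >-nonZero 1≤r
  open Switching r e g h m {{r≢0}} {{e≢0}} {{g≢0}} e*g≤r (λ s → e ^ s) (λ s → g * r ^ s)
    (λ {s} → m^n≢0 e s {{e≢0}}) (λ {s} → m*n≢0 g (r ^ s) {{g≢0}} {{m^n≢0 r s {{r≢0}}}})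
    refl (λ s → *-comm e (e ^ s))
    (*-identityʳ g) (λ s → trans (cong (g *_) (*-comm r (r ^ s))) (sym (*-assoc g (r ^ s) r))) member
  depth≡ : length layers ≡ k
  depth≡ = trans length-layers (sym k≡)
  room′ : suc (length layers) * e ^ suc h * (2 * N) + suc r ≤ n
  room′ = ≤-trans (+-monoˡ-≤ (suc r) (*-monoˡ-≤ (2 * N) (*-mono-≤ (s≤s (≤-reflexive depth≡)) e^[1+h]≤))) room

abstract
  gadget : ∀ k {n N X U} (S : Fin N → Subset U) → 2 ≤ k n → 1 ≤ N → 8 ≤ n → 2 ≤ X → U ≤ X →
    suc (k n) * 2 ≤ X * X → N * (X * X * (X * X)) * 2 ≤ n → Gadget k n S
  gadget k {n} {N} {X} {U} S 2≤k 1≤N 8≤n 2≤X U≤X 2[1+k]≤X² 2NX⁴≤n =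
    fromRoot (root (k n) {{>-nonZero (≤-trans (s≤s z≤n) 2≤k)}} (≤-trans (s≤s z≤n) 8≤n))
    where
    open ≤-Reasoning
    open Membership S
    fromRoot : ∃[ t ] t ^ k n < n × n ≤ suc t ^ k n → Gadget k n S
    fromRoot (t , t^k<n , n≤r^k) = record
      { graph      = graph
      -- Origin of the constants 1 and 4: the maximum degree lies between `r = suc t` and
      -- `2 * r ≤ 4 * t`, while `n ≤ r ^ k n` and `t ^ k n < n`.
      ; degrees    = ≤-trans n≤r^k (^-monoˡ-≤ (k n) (≤-trans r≤maxDegree (≤-reflexive (sym (+-identityʳ _)))))
                   , (begin
                       Graph.maxDegree graph ^ k n ≤⟨ ^-monoˡ-≤ (k n) (≤-trans maxDegree≤r+r 2r≤4t) ⟩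
                       (4 * t) ^ k n               ≡⟨ ^-distribʳ-* 4 t (k n) ⟩
                       4 ^ k n * t ^ k n           ≤⟨ *-monoʳ-≤ (4 ^ k n) (<⇒≤ t^k<n) ⟩
                       4 ^ k n * n                 ∎)
      ; offset     = offset
      ; source     = source
      ; target     = target
      ; toℕ-source = toℕ-source
      ; toℕ-target = toℕ-target
      ; near       = λ i j (x , x∈) → near i j (<-≤-trans (toℕ<n x) U≤X)
          (member⁺ (proj₁ (x∈p∩q⁻ (S i) (S j) x∈))) (member⁺ (proj₂ (x∈p∩q⁻ (S i) (S j) x∈)))
      ; far        = λ i j disjoint → far i j (λ common → disjoint (common⁻ common))
      }
      where
      1≤t : 1 ≤ t
      1≤t = n≢0⇒n>0 λ { refl →
        contradiction (subst (n ≤_) (^-zeroˡ (k n)) n≤r^k) (<⇒≱ (≤-trans (s≤s (s≤s z≤n)) 8≤n)) }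
      2r≤4t : suc t + suc t ≤ 4 * t
      2r≤4t = ≤-trans (+-mono-≤ (+-monoˡ-≤ t 1≤t) (+-monoˡ-≤ t 1≤t)) (≤-reflexive (four t))
        where
        four : ∀ t → t + t + (t + t) ≡ 4 * t
        four = solve-∀
      room : suc (k n) * (X * X) * (2 * N) + suc (suc t) ≤ n
      room = *-cancelʳ-≤ (suc (k n) * (X * X) * (2 * N) + suc (suc t)) n 2 (begin
        (suc (k n) * (X * X) * (2 * N) + suc (suc t)) * 2
          ≡⟨ distribute (suc (k n)) (X * X) N (suc (suc t)) ⟩
        N * (suc (k n) * 2 * (X * X)) * 2 + suc (suc t) * 2
          ≤⟨ +-mono-≤ (*-monoˡ-≤ 2 (*-monoʳ-≤ N (*-monoˡ-≤ (X * X) 2[1+k]≤X²))) (2[1+r]≤n 2≤k 8≤n t^k<n) ⟩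
        N * (X * X * (X * X)) * 2 + n
          ≤⟨ +-monoˡ-≤ n 2NX⁴≤n ⟩
        n + n
          ≡⟨ double n ⟩
        n * 2 ∎)
        where
        distribute : ∀ a b c d → (a * b * (2 * c) + d) * 2 ≡ c * (a * 2 * b) * 2 + d * 2
        distribute = solve-∀
        double : ∀ a → a + a ≡ a * 2
        double = solve-∀
      open Hosting (networkHosting member
        (radices 2≤k 2≤X (s≤s 1≤t) 1≤N n≤r^k (≤-trans (m≤m*n (N * (X * X * (X * X))) 2) 2NX⁴≤n))
        1≤N z<s room)

-- From distance oracles to set intersection

least : ∀ {P : ℕ → Set} → (∀ n → Dec (P n)) → (s : ℕ → ℕ) → ∀ b →
  (∃[ n ] P n × (∀ {m} → m < b → P m → s n ≤ s m)) ⊎ (∀ {m} → m < b → ¬ P m)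
least P? s zero = inj₂ λ ()
least P? s (suc b) with P? b | least P? s b
... | no ¬Pb | inj₂ none = inj₂ λ m<1+b Pm →
  [ (λ m<b → none m<b Pm) , (λ { refl → ¬Pb Pm }) ]′ (m<1+n⇒m<n∨m≡n m<1+b)
... | no ¬Pb | inj₁ (n , Pn , min) = inj₁ (n , Pn , λ m<1+b Pm →
  [ (λ m<b → min m<b Pm) , (λ { refl → contradiction Pm ¬Pb }) ]′ (m<1+n⇒m<n∨m≡n m<1+b))
... | yes Pb | inj₂ none = inj₁ (b , Pb , λ m<1+b Pm →
  [ (λ m<b → contradiction Pm (none m<b)) , (λ { refl → ≤-refl }) ]′ (m<1+n⇒m<n∨m≡n m<1+b))
... | yes Pb | inj₁ (n , Pn , min) with s n ≤? s b
...   | yes sn≤sb = inj₁ (n , Pn , λ m<1+b Pm →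
  [ (λ m<b → min m<b Pm) , (λ { refl → sn≤sb }) ]′ (m<1+n⇒m<n∨m≡n m<1+b))
...   | no  sn≰sb = inj₁ (b , Pb , λ m<1+b Pm →
  [ (λ m<b → ≤-trans (≰⇒≥ sn≰sb) (min m<b Pm)) , (λ { refl → ≤-refl }) ]′ (m<1+n⇒m<n∨m≡n m<1+b))

stretch-bound : ∀ k {d̂} → (+ d̂) ℤ.≤ ((+ k) ℤ.⊔ (+ 2 ℤ.* (+ k) ℤ.+ (+ 1 - + k))) → d̂ ≤ suc k
stretch-bound k le = ℤ.drop‿+≤+ (ℤ.≤-trans le
  (ℤ.⊔-lub (ℤ.+≤+ (n≤1+n k)) (ℤ.≤-reflexive (identity (+ k)))))
  where
  identity : ∀ a → + 2 ℤ.* a ℤ.+ (+ 1 - a) ≡ + 1 ℤ.+ a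
  identity = ℤ-Solver.solve-∀

estimate-just : ∀ {w} (a : Word w) {d} → estimate a ≡ just d → value a ≡ d
estimate-just {w} a eq with suc (value a) ≡ᵇ 2 ^ w
estimate-just a refl | false = refl

estimate-nothing : ∀ {w} (a : Word w) → estimate a ≡ nothing → suc (value a) ≡ 2 ^ w
estimate-nothing {w} a eq with suc (value a) ≡ᵇ 2 ^ w in full
... | true = ≡ᵇ⇒≡ (suc (value a)) (2 ^ w) (Equivalence.from T-≡ full)

module _ {n w} {G : Graph n} {u v : Fin n} {k : ℕ} {a : Word w}
  (good : ∀ d → IsDistance G u v d → WithinStretch (+ 2) (+ 1 - + k) d (estimate a)) where

  open Graph G

  near⇒small : IsDistance G u v (just k) → value a < 2 + k
  near⇒small dist with estimate a in eq | good (just k) dist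
  ... | just d̂ | _ , le = s≤s (subst (_≤ suc k) (sym (estimate-just a eq)) (stretch-bound k le))

  -- No distance has to be computed, since the goal is a negation. A path without shorter ones
  -- realises the distance, and this contradicts a small estimate; so strong induction on the length
  -- refutes all paths. Then the estimate must be ∞, the all-ones word, which `2 + k < 2 ^ w` makes
  -- too large.
  far⇒large : 2 + k < 2 ^ w → (∀ {ℓ} → Path u v ℓ → 2 + k ≤ ℓ) → ¬ value a < 2 + k
  far⇒large fits far small = infinite (good nothing λ ℓ → unreachable ℓ)
    where
    unreachable : ∀ ℓ → ¬ Path u v ℓ
    unreachable = <-rec (λ ℓ → ¬ Path u v ℓ) λ ℓ shorter π →
      finite ℓ (far π) (good (just ℓ) (π , λ m π′ → ≮⇒≥ λ m<ℓ → shorter m<ℓ π′))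
      where
      finite : ∀ ℓ → 2 + k ≤ ℓ → ¬ WithinStretch (+ 2) (+ 1 - + k) (just ℓ) (estimate a)
      finite ℓ k<ℓ stretch with estimate a in eq
      finite ℓ k<ℓ (ℓ≤d̂ , _) | just d̂ = <-irrefl refl (begin-strict
        value a  <⟨ small ⟩
        2 + k    ≤⟨ k<ℓ ⟩
        ℓ        ≤⟨ ℓ≤d̂ ⟩
        d̂        ≡⟨ estimate-just a eq ⟨
        value a  ∎)
        where open ≤-Reasoning
    infinite : ¬ WithinStretch (+ 2) (+ 1 - + k) nothing (estimate a)
    infinite stretch with estimate a in eq
    ... | nothing = <⇒≱ fits (≤-trans (≤-reflexive (sym (estimate-nothing a eq))) small)

contents-tabulate : ∀ {w m} (f : Fin m → Word w) i → contents (tabulate f) (toℕ i) ≡ f i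
contents-tabulate f Fin.zero    = refl
contents-tabulate f (Fin.suc i) = contents-tabulate (λ i → f (Fin.suc i)) i

map-just⁻ : ∀ {A B : Set} {f : A → B} {x y} → Maybe.map f x ≡ just y → ∃[ z ] x ≡ just z × f z ≡ y
map-just⁻ {x = just z} refl = z , refl , refl

OracleProblem : (ℕ → ℕ) → Problem
OracleProblem k = ADO (λ n → (2 ≤ k n) × (k n ≤ ⌊log₂ n ⌋)) (MaxDegreeΘRoot 1 4 k)
                      (λ _ → + 2) (λ n → + 1 - + k n)

bit : ∀ {w} {P : Set} → Dec P → Word w
bit {w} P? = word w (if does P? then 1 else 0)

-- The data structure for set intersection built from an oracle

module Reduce (c₀ : ℕ) (k : ℕ → ℕ) (D : DataStructure (OracleProblem k))
  (solves : DataStructure.Solves D) (s : ℕ → ℕ) (uses : DataStructure.UsesAtMost D s) where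

  private
    module D = DataStructure D

  -- The extra power makes `X n` at least log n even for `c₀ = 0`, so that `X n * X n` also absorbs
  -- the number of layers.
  X : ℕ → ℕ
  X n = ⌊log₂ n ⌋ ^ suc c₀

  -- `N ≤ n` lets the words of the oracle name all sets. `n ≤ N * N` keeps its word size in O(log N)
  -- and makes the search for `n` finite. The last condition is the slack needed by the gadget.
  Suitable : ℕ → ℕ → Set
  Suitable N n = (2 ≤ k n) × (k n ≤ ⌊log₂ n ⌋) × N ≤ n × n ≤ N * N × 4 ≤ ⌊log₂ n ⌋ × 8 ≤ n ×
    N * (X n * X n * (X n * X n)) * 2 ≤ n

  suitable? : ∀ N n → Dec (Suitable N n)
  suitable? N n = (2 ≤? k n) ×-dec ((k n ≤? ⌊log₂ n ⌋) ×-dec ((N ≤? n) ×-dec ((n ≤? N * N) ×-dec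
    ((4 ≤? ⌊log₂ n ⌋) ×-dec ((8 ≤? n) ×-dec (N * (X n * X n * (X n * X n)) * 2 ≤? n))))))

  Choice : ℕ → Set
  Choice N = (∃[ n ] Suitable N n × (∀ {m} → m < suc (N * N) → Suitable N m → s n ≤ s m))
           ⊎ (∀ {m} → m < suc (N * N) → ¬ Suitable N m)

  choose : ∀ N → Choice N
  choose N = least (suitable? N) s (suc (N * N))

  module Fit {N n} (suitable : Suitable N n) where

    private
      ℓ = ⌊log₂ n ⌋
      2≤k  = proj₁ suitable
      k≤ℓ  = proj₁ (proj₂ suitable)
      N≤n  = proj₁ (proj₂ (proj₂ suitable))
      n≤N² = proj₁ (proj₂ (proj₂ (proj₂ suitable)))
      4≤ℓ  = proj₁ (proj₂ (proj₂ (proj₂ (proj₂ suitable))))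
      8≤n  = proj₁ (proj₂ (proj₂ (proj₂ (proj₂ (proj₂ suitable)))))
      fits = proj₂ (proj₂ (proj₂ (proj₂ (proj₂ (proj₂ suitable)))))
      ℓ≤X : ℓ ≤ X n
      ℓ≤X = m≤m^k ℓ (suc c₀)
      4≤X : 4 ≤ X n
      4≤X = ≤-trans 4≤ℓ ℓ≤X
      1≤N : 1 ≤ N
      1≤N = n≢0⇒n>0 λ { refl → contradiction n≤N² (<⇒≱ (≤-trans (s≤s z≤n) 8≤n)) }
      U≤X : ⌊log₂ N ⌋ ^ c₀ ≤ X n
      U≤X = ≤-trans (^-monoˡ-≤ c₀ (⌊log₂⌋-mono-≤ N≤n))
                    (m≤n*m (ℓ ^ c₀) ℓ {{>-nonZero (≤-trans (s≤s z≤n) 4≤ℓ)}})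
      2[1+k]≤X² : suc (k n) * 2 ≤ X n * X n
      2[1+k]≤X² = begin
        suc (k n) * 2       ≤⟨ *-monoˡ-≤ 2 (s≤s (≤-trans k≤ℓ ℓ≤X)) ⟩
        suc (X n) * 2       ≤⟨ *-monoˡ-≤ 2 (+-monoˡ-≤ (X n) (≤-trans (s≤s z≤n) 4≤X)) ⟩
        (X n + X n) * 2     ≡⟨ shuffle (X n) ⟩
        X n * 4             ≤⟨ *-monoʳ-≤ (X n) 4≤X ⟩
        X n * X n           ∎
        where
        open ≤-Reasoning
        shuffle : ∀ x → (x + x) * 2 ≡ x * 4
        shuffle = solve-∀

    2+k≤n : 2 + k n ≤ n
    2+k≤n = begin
      2 + k n                          ≤⟨ +-monoʳ-≤ 2 (m≤m*n (k n) 2) ⟩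
      suc (k n) * 2                    ≤⟨ 2[1+k]≤X² ⟩
      X n * X n                        ≤⟨ m≤m*n (X n * X n) (X n * X n) {{X²≢0}} ⟩
      X n * X n * (X n * X n)          ≤⟨ m≤n*m (X n * X n * (X n * X n)) N {{>-nonZero 1≤N}} ⟩
      N * (X n * X n * (X n * X n))    ≤⟨ m≤m*n (N * (X n * X n * (X n * X n))) 2 ⟩
      N * (X n * X n * (X n * X n)) * 2 ≤⟨ fits ⟩
      n                                ∎
      where
      open ≤-Reasoning
      X≢0 : NonZero (X n)
      X≢0 = >-nonZero (≤-trans (s≤s z≤n) 4≤X)
      X²≢0 : NonZero (X n * X n)
      X²≢0 = m*n≢0 (X n) (X n) {{X≢0}} {{X≢0}}

    hosting : (S : Fin N → Subset (⌊log₂ N ⌋ ^ c₀)) → Gadget k n S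
    hosting S = gadget k {n} {N} {X n} S 2≤k 1≤N 8≤n (≤-trans (s≤s (s≤s z≤n)) 4≤X) U≤X 2[1+k]≤X² fits

  open Wrapping (wrapping D.program)

  Sets : ℕ → Set
  Sets N = Fin N → Subset (⌊log₂ N ⌋ ^ c₀)

  width : ∀ {N} → Choice N → ℕ
  width         (inj₁ (n , _)) = D.wordSize n
  width {N = N} (inj₂ _)       = 2 * suc ⌊log₂ N ⌋

  N*N<2^ : ∀ N → N * N < 2 ^ (2 * suc ⌊log₂ N ⌋)
  N*N<2^ N = begin-strict
    N * N                                        <⟨ *-mono-< (n<2^[1+⌊log₂n⌋] N) (n<2^[1+⌊log₂n⌋] N) ⟩
    2 ^ suc ⌊log₂ N ⌋ * 2 ^ suc ⌊log₂ N ⌋        ≡⟨ ^-distribˡ-+-* 2 (suc ⌊log₂ N ⌋) (suc ⌊log₂ N ⌋) ⟨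
    2 ^ (suc ⌊log₂ N ⌋ + suc ⌊log₂ N ⌋)          ≡⟨ cong (λ a → 2 ^ (suc ⌊log₂ N ⌋ + a)) (+-identityʳ _) ⟨
    2 ^ (2 * suc ⌊log₂ N ⌋)                      ∎
    where open ≤-Reasoning

  N<2^ : ∀ N → N < 2 ^ (2 * suc ⌊log₂ N ⌋)
  N<2^ N = <-≤-trans (n<2^[1+⌊log₂n⌋] N) (^-monoʳ-≤ 2 (m≤n*m (suc ⌊log₂ N ⌋) 2))

  width-lower : ∀ {N} (c : Choice N) → N < 2 ^ width c
  width-lower     (inj₁ (n , (_ , _ , N≤n , _) , _)) = ≤-<-trans N≤n (D.wordSize-lower n)
  width-lower {N} (inj₂ _) = N<2^ N

  -- The first summand is doubled because `n ≤ N * N`; the second pays for the table, whose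
  -- addresses range up to `N * N`.
  factor : ℕ
  factor = D.wordFactor * 2 + 2

  width-upper : ∀ {N} (c : Choice N) → width c ≤ factor * suc ⌊log₂ N ⌋
  width-upper {N} (inj₂ _) = *-monoˡ-≤ (suc ⌊log₂ N ⌋) (m≤n+m 2 (D.wordFactor * 2))
  width-upper {N} (inj₁ (n , (_ , _ , _ , n≤N² , _) , _)) = begin
    D.wordSize n                            ≤⟨ D.wordSize-upper n ⟩
    D.wordFactor * suc ⌊log₂ n ⌋            ≤⟨ *-monoʳ-≤ D.wordFactor (s≤s (n<2^[1+m]⇒⌊log₂n⌋≤m _ (≤-<-trans n≤N² (N*N<2^ N)))) ⟩
    D.wordFactor * (2 * suc ⌊log₂ N ⌋)      ≡⟨ *-assoc D.wordFactor 2 (suc ⌊log₂ N ⌋) ⟨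
    D.wordFactor * 2 * suc ⌊log₂ N ⌋        ≤⟨ *-monoˡ-≤ (suc ⌊log₂ N ⌋) (m≤m+n (D.wordFactor * 2) 2) ⟩
    factor * suc ⌊log₂ N ⌋                  ∎
    where open ≤-Reasoning

  entry : ∀ {N w} → Sets N → Fin (N * N) → Word w
  entry {N} S q = bit (nonempty? (S (proj₁ (remQuot {N} N q)) ∩ S (proj₂ (remQuot {N} N q))))

  memory : ∀ {N} (c : Choice N) → Sets N → List (Word (width c))
  memory (inj₁ (n , suitable , _)) S =
    word _ 0 ∷ word _ offset ∷ word _ (2 + k n) ∷ D.preprocess n (graph , degrees)
    where open Gadget (Fit.hosting suitable S)
  memory {N} (inj₂ _) S = word _ N ∷ word _ 0 ∷ word _ 0 ∷ tabulate (entry S)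

  space : ∀ {N} → Choice N → ℕ
  space         (inj₁ (n , _)) = 3 + s n
  space {N = N} (inj₂ _)       = 3 + N * N

  length-memory : ∀ {N} (c : Choice N) S → length (memory c S) ≤ space c
  length-memory (inj₁ (n , suitable@(2≤k , k≤ , _) , _)) S = +-monoʳ-≤ 3 (uses n (2≤k , k≤) _)
  length-memory (inj₂ _) S = +-monoʳ-≤ 3 (≤-reflexive (length-tabulate (entry S)))

  IsAnswer : ∀ {w} → Set → Word w → Set
  IsAnswer P a = (P → value a ≡ 1) × (¬ P → value a ≡ 0)

  Answered : ∀ {N w} → Sets N → (i j : Fin N) → List (Word w) → Set
  Answered {N} {w} S i j M = ∃[ σ ]
    run wrapped (11 + D.time) (state 0 (inputs (word w (toℕ i)) (word w (toℕ j))) (contents M)) ≡ just σ ×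
    IsAnswer (Nonempty (S i ∩ S j)) (State.reg σ 0)

  module Oracle {N n} (suitable : Suitable N n) (S : Sets N) (host : Gadget k n S) (i j : Fin N) where

    open Gadget host

    w = D.wordSize n

    n<2^w : n < 2 ^ w
    n<2^w = D.wordSize-lower n

    value-j : value (word w (toℕ j)) ≡ toℕ j
    value-j = value-word w (<-≤-trans (toℕ<n j) (≤-trans (proj₁ (proj₂ (proj₂ suitable))) (<⇒≤ n<2^w)))

    value-0 : value (word w 0) ≡ 0
    value-0 = value-word w (≤-<-trans z≤n n<2^w)

    value-2+k : value (word w (2 + k n)) ≡ 2 + k n
    value-2+k = value-word w (≤-<-trans (Fit.2+k≤n suitable) n<2^w)

    value-offset : value (word w offset) ≡ offset
    value-offset = value-word w (≤-<-trans
      (≤-trans (m≤n+m offset (toℕ j)) (≤-reflexive (sym (toℕ-target j)))) (<-trans (toℕ<n (target j)) n<2^w))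

    1<2^w : 1 < 2 ^ w
    1<2^w = ≤-<-trans (≤-trans (s≤s z≤n) (Fit.2+k≤n suitable)) n<2^w

    cells : List (Word w)
    cells = D.preprocess n (graph , degrees)

    Small : Word w → Bool
    Small a = value a <ᵇ value (word w (2 + k n))

    correct⇒isAnswer : ∀ {a b : Word w} →
      (∀ d → IsDistance graph (source i) (target j) d → WithinStretch (+ 2) (+ 1 - + k n) d (estimate a)) →
      value b ≡ (if Small a then 1 else 0) → IsAnswer (Nonempty (S i ∩ S j)) b
    correct⇒isAnswer {a} {b} correct outcome = meeting , disjoint
      where
      meeting : Nonempty (S i ∩ S j) → value b ≡ 1
      meeting common = trans outcome (cong (λ b → if b then 1 else 0) (Equivalence.to T-≡
        (<⇒<ᵇ (subst (value a <_) (sym value-2+k)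
          (near⇒small {G = graph} {u = source i} {v = target j} {k = k n} {a = a} correct (near i j common))))))
      disjoint : ¬ Nonempty (S i ∩ S j) → value b ≡ 0
      disjoint ¬common = trans outcome (cong (λ b → if b then 1 else 0) (¬T⇒false λ small →
        far⇒large {G = graph} {u = source i} {v = target j} {k = k n} {a = a} correct
          (≤-<-trans (Fit.2+k≤n suitable) n<2^w) (far i j ¬common)
          (subst (value a <_) value-2+k (<ᵇ⇒< (value a) (value (word w (2 + k n))) small))))
        where
        ¬T⇒false : ∀ {b} → ¬ T b → b ≡ false
        ¬T⇒false {false} _  = refl
        ¬T⇒false {true}  ¬t = contradiction tt ¬t

    target≡ : word w (toℕ (target j)) ≡ word w (value (word w (toℕ j)) + value (word w offset))
    target≡ = cong (word w) (trans (toℕ-target j) (sym (cong₂ _+_ value-j value-offset)))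

    oracle : Word w → Word w → Maybe (State w)
    oracle x y = run D.program D.time (state 0 (inputs x y) (contents cells))

    answered : ∃[ a ] Maybe.map (λ σ → State.reg σ 0)
        (oracle (word w (toℕ (source i))) (word w (toℕ (target j)))) ≡ just a ×
        (∀ d → IsDistance graph (source i) (target j) d → WithinStretch (+ 2) (+ 1 - + k n) d (estimate a)) →
      Answered S i j (word w 0 ∷ word w offset ∷ word w (2 + k n) ∷ cells)
    answered (a , found , correct) = finish (map-just⁻ found)
      where
      finish : ∃[ τ ] oracle (word w (toℕ (source i))) (word w (toℕ (target j))) ≡ just τ × State.reg τ 0 ≡ a →
        Answered S i j (word w 0 ∷ word w offset ∷ word w (2 + k n) ∷ cells)
      finish (τ , ran , refl) = proj₁ wrappedRun , proj₁ (proj₂ wrappedRun) ,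
        correct⇒isAnswer {State.reg τ 0} {State.reg (proj₁ wrappedRun) 0} correct (proj₂ (proj₂ wrappedRun))
        where
        wrappedRun = run-oracle {w} 1<2^w {word w 0} {word w offset} {word w (2 + k n)} {cells}
          (word w (toℕ i)) (word w (toℕ j)) {D.time} {τ} value-0
          (subst₂ (λ x y → oracle x y ≡ just τ) (cong (word w) (toℕ-source i)) target≡ ran)

  module Table {N} (S : Sets (suc N)) (i j : Fin (suc N)) where

    w = 2 * suc ⌊log₂ suc N ⌋

    value-toℕ : ∀ i → value (word w (toℕ {suc N} i)) ≡ toℕ i
    value-toℕ i = value-word w (<-trans (toℕ<n i) (N<2^ (suc N)))

    1<2^w : 1 < 2 ^ w
    1<2^w = ≤-<-trans (s≤s z≤n) (N<2^ (suc N))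

    position : ℕ
    position = value (word w (toℕ i)) * suc N + value (word w (toℕ j))

    position≡ : position ≡ toℕ (combine i j)
    position≡ = trans (cong₂ (λ a b → a * suc N + b) (value-toℕ i) (value-toℕ j))
      (trans (cong (_+ toℕ j) (*-comm (toℕ i) (suc N))) (sym (toℕ-combine i j)))

    position< : position < 2 ^ w
    position< = subst (_< 2 ^ w) (sym position≡) (<-trans (toℕ<n (combine i j)) (N*N<2^ (suc N)))

    lookup : contents (tabulate (entry {suc N} {w} S)) position ≡ bit (nonempty? (S i ∩ S j))
    lookup = begin
      contents (tabulate (entry S)) position            ≡⟨ cong (contents (tabulate (entry S))) position≡ ⟩
      contents (tabulate (entry S)) (toℕ (combine i j)) ≡⟨ contents-tabulate (entry S) (combine i j) ⟩
      entry S (combine i j)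
        ≡⟨ cong (λ q → bit (nonempty? (S (proj₁ q) ∩ S (proj₂ q)))) (remQuot-combine {suc N} {suc N} i j) ⟩
      bit (nonempty? (S i ∩ S j))                       ∎
      where open ≡-Reasoning

    bit-isAnswer : ∀ {P : Set} (P? : Dec P) → IsAnswer P (bit {w} P?)
    bit-isAnswer (yes p) = (λ _ → value-word w 1<2^w) , λ ¬p → contradiction p ¬p
    bit-isAnswer (no ¬p) = (λ p → contradiction p ¬p) , λ _ → value-word w (<-trans z<s 1<2^w)

    answered : Answered S i j (word w (suc N) ∷ word w 0 ∷ word w 0 ∷ tabulate (entry S))
    answered = proj₁ wrappedRun , proj₁ (proj₂ wrappedRun) ,
      subst (IsAnswer (Nonempty (S i ∩ S j))) (sym (trans (proj₂ (proj₂ wrappedRun)) lookup))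
            (bit-isAnswer (nonempty? (S i ∩ S j)))
      where
      wrappedRun = run-table {w} 1<2^w {word w (suc N)} {word w 0} {word w 0} {tabulate (entry S)}
        (word w (toℕ i)) (word w (toℕ j)) D.time (value-word w (N<2^ (suc N))) position<

  answered : ∀ {N} (c : Choice N) S i j → Answered S i j (memory c S)
  answered (inj₁ (n , suitable , _)) S i j =
    Oracle.answered suitable S host i j
      (solves n (proj₁ suitable , proj₁ (proj₂ suitable)) (graph , degrees) (source i) (target j))
    where
    host = Fit.hosting suitable S
    open Gadget host
  -- Without sets the flag cell would be zero and select the oracle, but then there are no queries.
  answered {suc N} (inj₂ _) S i j = Table.answered S i j

  reduced : DataStructure (SetIntersection c₀)
  reduced = record
    { wordSize       = λ N → width (choose N)
    ; wordSize-lower = λ N → width-lower (choose N)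
    ; wordFactor     = factor
    ; wordSize-upper = λ N → width-upper (choose N)
    ; preprocess     = λ N → memory (choose N)
    ; program        = wrapped
    ; time           = 11 + D.time
    }

  reduced-solves : DataStructure.Solves reduced
  reduced-solves N _ S i j = State.reg σ 0 , cong (Maybe.map (λ σ → State.reg σ 0)) ran , isAnswer
    where
    run-answered = answered (choose N) S i j
    σ = proj₁ run-answered
    ran = proj₁ (proj₂ run-answered)
    isAnswer = proj₂ (proj₂ run-answered)

  reduced-uses : DataStructure.UsesAtMost reduced (λ N → space (choose N))
  reduced-uses N _ S = length-memory (choose N) S

  -- The structure for `N` uses a single size, yet minimality puts its space below the bound at
  -- every suitable `n`, and so the lower bound at `N` reaches all of them. A suitable `n` also
  -- rules out the table.
  space-≤ : ∀ {N n} → Suitable N n → space (choose N) ≤ 3 + s n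
  space-≤ {N} suitable with choose N
  ... | inj₁ (_ , _ , min) = +-monoʳ-≤ 3 (min (s≤s (proj₁ (proj₂ (proj₂ (proj₂ suitable))))) suitable)
  ... | inj₂ none          = contradiction suitable (none (s≤s (proj₁ (proj₂ (proj₂ (proj₂ suitable))))))

-- Asymptotics: the number of sets for a given n

module Asymptotics (c₀ c n₀ : ℕ) where

  -- With ℓ = log n, X^4 is ℓ^(a + a), and `C` has one more power of ℓ for the factor 2 in the
  -- slack; N is n / ℓ^C. In `E`, `C + C` comes from squaring n / N and `c` from the hypothesis. The
  -- remaining ℓ^2 covers the constant 16: a factor 4 from `n ≤ N * (2 * W)` squared, and a factor 4
  -- from `3 + s ≤ s * 4`, which absorbs the three private cells.
  a C E : ℕ
  a = suc c₀ + suc c₀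
  C = suc (a + a)
  E = 2 + (C + C) + c

  -- The first summand gives `n₀ + 8 ≤ ℓ`, whence `n₀ ≤ ℓ ≤ N`; the second gives `ℓ ^ E ≤ n`.
  threshold : ℕ
  threshold = 2 ^ (n₀ + 8) + 2 ^ (suc E ^ suc E)

  module _ {n} (large : threshold ≤ n) where

    ℓ W : ℕ
    ℓ = ⌊log₂ n ⌋
    W = ℓ ^ C

    n₀+8≤ℓ : n₀ + 8 ≤ ℓ
    n₀+8≤ℓ = 2^m≤n⇒m≤⌊log₂n⌋ (n₀ + 8) (m+n≤o⇒m≤o (2 ^ (n₀ + 8)) large)

    8≤ℓ : 8 ≤ ℓ
    8≤ℓ = ≤-trans (m≤n+m 8 n₀) n₀+8≤ℓ

    ℓ^E≤n : ℓ ^ E ≤ n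
    ℓ^E≤n = ⌊log₂n⌋^c≤n E (m+n≤o⇒n≤o (2 ^ (n₀ + 8)) large)

    instance
      ℓ≢0 : NonZero ℓ
      ℓ≢0 = >-nonZero (≤-trans (s≤s z≤n) 8≤ℓ)

      W≢0 : NonZero W
      W≢0 = m^n≢0 ℓ C

    ℓ^≤n : ∀ {b} → b ≤ E → ℓ ^ b ≤ n
    ℓ^≤n b≤E = ≤-trans (^-monoʳ-≤ ℓ b≤E) ℓ^E≤n

    8≤n : 8 ≤ n
    8≤n = ≤-trans 8≤ℓ (≤-trans (m≤m^k ℓ E) ℓ^E≤n)

    N : ℕ
    N = n / W

    ≤N : ∀ {b} → b * W ≤ n → b ≤ N
    ≤N {b} bW≤n = subst (_≤ N) (m*n/n≡m b W) (/-monoˡ-≤ W bW≤n)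

    ℓW≤n : ℓ * W ≤ n
    ℓW≤n = ℓ^≤n {suc C} (s≤s (m≤n⇒m≤1+n (≤-trans (m≤m+n C C) (m≤m+n (C + C) c))))

    n₀≤N : n₀ ≤ N
    n₀≤N = ≤-trans (≤-trans (m≤m+n n₀ 8) n₀+8≤ℓ) (≤N ℓW≤n)

    -- Turns `n ≤ N * (2 * W)` into `n ≤ N * N`, as suitability requires. It holds because
    -- `ℓ ^ suc (C + C)` is still at most `n`.
    2W≤N : 2 * W ≤ N
    2W≤N = ≤N (begin
      2 * W * W           ≡⟨ *-assoc 2 W W ⟩
      2 * (W * W)         ≤⟨ *-monoˡ-≤ (W * W) (≤-trans (s≤s (s≤s z≤n)) 8≤ℓ) ⟩
      ℓ * (W * W)         ≡⟨ cong (ℓ *_) (^-distribˡ-+-* ℓ C C) ⟨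
      ℓ ^ suc (C + C)     ≤⟨ ℓ^≤n (s≤s (m≤n⇒m≤1+n (m≤m+n (C + C) c))) ⟩
      n                   ∎)
      where open ≤-Reasoning

    1≤N : 1 ≤ N
    1≤N = ≤-trans (≤-trans (>-nonZero⁻¹ W) (m≤n*m W 2)) 2W≤N

    n≤2NW : n ≤ N * (2 * W)
    n≤2NW = begin
      n                  ≡⟨ m≡m%n+[m/n]*n n W ⟩
      n % W + N * W      ≤⟨ +-monoˡ-≤ (N * W) (m%n≤n n W) ⟩
      W + N * W          ≤⟨ +-monoˡ-≤ (N * W) (m≤n*m W N {{>-nonZero 1≤N}}) ⟩
      N * W + N * W      ≡⟨ double N W ⟩
      N * (2 * W)        ∎
      where
      open ≤-Reasoning
      double : ∀ x y → x * y + x * y ≡ x * (2 * y)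
      double = solve-∀

    n≤N² : n ≤ N * N
    n≤N² = ≤-trans n≤2NW (*-monoʳ-≤ N 2W≤N)

    fits : let X = ℓ ^ suc c₀ in N * (X * X * (X * X)) * 2 ≤ n
    fits = begin
      N * (X * X * (X * X)) * 2     ≡⟨ *-assoc N (X * X * (X * X)) 2 ⟩
      N * (X * X * (X * X) * 2)     ≡⟨ cong (λ x → N * (x * 2)) X⁴≡ ⟩
      N * (ℓ ^ (a + a) * 2)         ≤⟨ *-monoʳ-≤ N (*-monoʳ-≤ (ℓ ^ (a + a)) (≤-trans (s≤s (s≤s z≤n)) 8≤ℓ)) ⟩
      N * (ℓ ^ (a + a) * ℓ)         ≡⟨ cong (N *_) (*-comm (ℓ ^ (a + a)) ℓ) ⟩
      N * W                         ≤⟨ m/n*n≤m n W ⟩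
      n                             ∎
      where
      open ≤-Reasoning
      X = ℓ ^ suc c₀
      X⁴≡ : X * X * (X * X) ≡ ℓ ^ (a + a)
      X⁴≡ = trans (cong₂ _*_ X²≡ X²≡) (sym (^-distribˡ-+-* ℓ a a))
        where
        X²≡ : X * X ≡ ℓ ^ a
        X²≡ = sym (^-distribˡ-+-* ℓ (suc c₀) (suc c₀))

    conclude : ∀ {s} → N ^ 2 ≤ (3 + s) * ⌊log₂ N ⌋ ^ c → n ^ 2 ≤ s * ℓ ^ E
    conclude {s} N²≤ = positive s n²≤
      where
      open ≤-Reasoning
      square : ∀ m → m ^ 2 ≡ m * m
      square m = cong (m *_) (*-identityʳ m)
      16≤ℓ² : 16 ≤ ℓ * ℓ
      16≤ℓ² = ≤-trans (m≤m+n 16 48) (*-mono-≤ 8≤ℓ 8≤ℓ)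
      logN≤ℓ : ⌊log₂ N ⌋ ≤ ℓ
      logN≤ℓ = ⌊log₂⌋-mono-≤ (m/n≤m n W)
      power : ∀ x → x * (ℓ * ℓ * (W * W * ℓ ^ c)) ≡ x * ℓ ^ E
      power x = cong (x *_) (begin-equality
        ℓ * ℓ * (W * W * ℓ ^ c)          ≡⟨ *-assoc ℓ ℓ (W * W * ℓ ^ c) ⟩
        ℓ * (ℓ * (W * W * ℓ ^ c))        ≡⟨ cong (λ w → ℓ * (ℓ * (w * ℓ ^ c))) (^-distribˡ-+-* ℓ C C) ⟨
        ℓ * (ℓ * (ℓ ^ (C + C) * ℓ ^ c))  ≡⟨ cong (λ w → ℓ * (ℓ * w)) (^-distribˡ-+-* ℓ (C + C) c) ⟨
        ℓ ^ E                            ∎)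
      regroup : ∀ W s L → (s * L) * (2 * W * (2 * W)) ≡ s * 4 * (W * W * L)
      regroup = solve-∀
      n²≤ : n ^ 2 ≤ (3 + s) * 4 * (W * W * ℓ ^ c)
      n²≤ = begin
        n ^ 2                                   ≡⟨ square n ⟩
        n * n                                   ≤⟨ *-mono-≤ n≤2NW n≤2NW ⟩
        N * (2 * W) * (N * (2 * W))             ≡⟨ interchange N (2 * W) ⟩
        N * N * (2 * W * (2 * W))               ≡⟨ cong (_* (2 * W * (2 * W))) (square N) ⟨
        N ^ 2 * (2 * W * (2 * W))               ≤⟨ *-monoˡ-≤ (2 * W * (2 * W)) (≤-trans N²≤ (*-monoʳ-≤ (3 + s) (^-monoˡ-≤ c logN≤ℓ))) ⟩
        (3 + s) * ℓ ^ c * (2 * W * (2 * W))     ≡⟨ regroup W (3 + s) (ℓ ^ c) ⟩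
        (3 + s) * 4 * (W * W * ℓ ^ c)           ∎
        where
        interchange : ∀ x y → x * y * (x * y) ≡ x * x * (y * y)
        interchange = solve-∀
      -- A vanishing bound on the space would give n² ≤ polylog n.
      positive : ∀ s → n ^ 2 ≤ (3 + s) * 4 * (W * W * ℓ ^ c) → n ^ 2 ≤ s * ℓ ^ E
      positive zero n²≤ = contradiction (begin
        n * 2                                   ≤⟨ *-monoʳ-≤ n (≤-trans (s≤s (s≤s z≤n)) 8≤n) ⟩
        n * n                                   ≡⟨ square n ⟨
        n ^ 2                                   ≤⟨ n²≤ ⟩
        12 * (W * W * ℓ ^ c)                    ≤⟨ *-monoˡ-≤ (W * W * ℓ ^ c) (≤-trans (m≤m+n 12 4) 16≤ℓ²) ⟩
        ℓ * ℓ * (W * W * ℓ ^ c)                 ≡⟨ *-identityˡ _ ⟨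
        1 * (ℓ * ℓ * (W * W * ℓ ^ c))           ≡⟨ power 1 ⟩
        1 * ℓ ^ E                               ≡⟨ *-identityˡ _ ⟩
        ℓ ^ E                                   ≤⟨ ℓ^E≤n ⟩
        n                                       ∎)
        (<⇒≱ (m<m*n n 2 {{>-nonZero (≤-trans (s≤s z≤n) 8≤n)}} (s≤s (s≤s z≤n))))
      positive s@(suc s′) n²≤ = begin
        n ^ 2                                   ≤⟨ n²≤ ⟩
        (3 + s) * 4 * (W * W * ℓ ^ c)           ≤⟨ *-monoˡ-≤ (W * W * ℓ ^ c) (*-monoˡ-≤ 4 3+s≤) ⟩
        s * 4 * 4 * (W * W * ℓ ^ c)             ≡⟨ cong (_* (W * W * ℓ ^ c)) (*-assoc s 4 4) ⟩
        s * 16 * (W * W * ℓ ^ c)                ≤⟨ *-monoˡ-≤ (W * W * ℓ ^ c) (*-monoʳ-≤ s 16≤ℓ²) ⟩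
        s * (ℓ * ℓ) * (W * W * ℓ ^ c)           ≡⟨ *-assoc s (ℓ * ℓ) (W * W * ℓ ^ c) ⟩
        s * (ℓ * ℓ * (W * W * ℓ ^ c))           ≡⟨ power s ⟩
        s * ℓ ^ E                               ∎
        where
        3+s≤ : 3 + s ≤ s * 4
        3+s≤ = begin
          3 + s                ≤⟨ m≤m+n (3 + s) (3 * s′) ⟩
          3 + s + 3 * s′       ≡⟨ expand s′ ⟩
          s * 4                ∎
          where
          expand : ∀ x → 3 + suc x + 3 * x ≡ suc x * 4
          expand = solve-∀

theorem1p5 : SetIntersectionHypothesis →
    ∃[ A ] ∃[ B ] ((k : ℕ → ℕ) →
    RequiresSpaceΩ̃ (λ n → n ^ 2)
    (ADO (λ n → (2 ≤ k n) × (k n ≤ ⌊log₂ n ⌋))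
    (MaxDegreeΘRoot A B k)
    (λ n → + 2)
    (λ n → + 1 - + k n)))
theorem1p5 (c₀ , hypothesis) = 1 , 4 , λ k D solves s uses →
  let open Reduce c₀ k D solves s uses
      c , n₀ , bound = hypothesis reduced reduced-solves (λ N → space (choose N)) reduced-uses
      open Asymptotics c₀ c n₀
  in E , threshold , λ n large (2≤k , k≤ℓ) →
    conclude large {s n} (≤-trans (bound (N large) (n₀≤N large) tt)
      (*-monoˡ-≤ (⌊log₂ N large ⌋ ^ c) (space-≤
        (2≤k , k≤ℓ , m/n≤m n (W large) {{W≢0 large}} , n≤N² large ,
         ≤-trans (m≤m+n 4 4) (8≤ℓ large) , 8≤n large , fits large))))
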